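{- Let $t \ge 3$ be an integer. Then every (finite, simple) graph $G$ that does not contain $K_t$ as an odd minor admits a (not necessarily proper) vertex-coloring $c: V(G)\to S$ with $|S| = 2t-2$ colors such that every monochromatic component has at most $\lceil \frac{1}{2}(t-2) \rceil$ vertices.
   Context: For an integer $t\ge 1$, a $K_t$-expansion is a graph $F$ consisting of $t$ vertex-disjoint trees $T_1,\dots,T_t$ together with, for each pair of distinct trees, exactly one additional edge joining them. A $K_t$-expansion $F$ is odd if there is a $2$-coloring of $V(F)$ whose restriction to each tree $T_s$ is a proper coloring of $T_s$, while every edge joining two distinct trees has both endpoints of the same color. A graph $G$ contains $K_t$ as an odd minor if some subgraph of $G$ is an odd $K_t$-expansion. For a vertex-coloring $c:V(G)\to S$ (not necessarily proper), a monochromatic component is a vertex set that is a connected component of the induced subgraph $G[c^{ -1}(s)]$ for some color $s\in S$. -}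

module Defs where

open import Level using (0ℓ)
open import Data.Bool.Base using (Bool)
open import Data.Nat.Base using (ℕ; _≤_)
open import Data.Fin.Base using (Fin)
open import Data.Fin.Properties using (_≟_)
open import Data.Fin.Subset using (Subset; _∈_; _⊆_; _∩_; Nonempty)
open import Data.Fin.Subset.Properties using (_∈?_; x∈p∩q⁺)
open import Data.List.Base using (List; _∷_; _∷ʳ_; length)
open import Data.List.Relation.Unary.Linked using (Linked)
open import Data.List.Relation.Unary.Unique.Propositional using (Unique)
open import Data.Product using (∃; ∃!; Σ-syntax; _×_; _,_)
open import Data.Vec.Base using (tabulate)
open import Function.Bundles using (_⇔_)
open import Relation.Binary.Core using (Rel)
open import Relation.Binary.Definitions using (Decidable; Symmetric; Irreflexive)
open import Relation.Binary.Construct.Closure.ReflexiveTransitive using (Star)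
open import Relation.Binary.PropositionalEquality using (_≡_; _≢_)
open import Relation.Nullary using (¬_)
open import Relation.Nullary.Decidable using (does; _×-dec_)

-- A finite simple graph whose vertex set V is an arbitrary subset of Fin n.
-- Carrying V lets a graph and its subgraphs live in the same type; elements
-- of Fin n outside V are not vertices.
record Graph (n : ℕ) : Set₁ where
  infix 4 _~_ _~?_
  field
    V        : Subset n
    _~_      : Rel (Fin n) 0ℓ
    _~?_     : Decidable _~_
    ~-sym    : Symmetric _~_
    ~-irrefl : Irreflexive _≡_ _~_
    ~⇒∈V     : ∀ {u v} → u ~ v → u ∈ V

open Graph public using (V)

infix 4 _⊆ᴳ_

_⊆ᴳ_ : {n : ℕ} → Graph n → Graph n → Set
H ⊆ᴳ G = V H ⊆ V G × (∀ {u v} → Graph._~_ H u v → Graph._~_ G u v)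

induced : {n : ℕ} → Graph n → Subset n → Graph n
induced G X = record
  { V        = V G ∩ X
  ; _~_      = λ u v → u ~ v × u ∈ X × v ∈ X
  ; _~?_     = λ u v → (u ~? v) ×-dec (u ∈? X) ×-dec (v ∈? X)
  ; ~-sym    = λ (e , u∈X , v∈X) → ~-sym e , v∈X , u∈X
  ; ~-irrefl = λ u≡v (e , _) → ~-irrefl u≡v e
  ; ~⇒∈V     = λ (e , u∈X , _) → x∈p∩q⁺ (~⇒∈V e , u∈X)
  }
  where open Graph G hiding (V)

Reachable : {n : ℕ} → Graph n → Rel (Fin n) 0ℓ
Reachable G = Star (Graph._~_ G)

Connected : {n : ℕ} → Graph n → Set
Connected G = Nonempty (V G) × (∀ {u v} → u ∈ V G → v ∈ V G → Reachable G u v)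

-- The closed walk v, vs, v, whose vertices v ∷ vs are distinct and number at
-- least three.
IsCycle : {n : ℕ} → Graph n → Fin n → List (Fin n) → Set
IsCycle G v vs =
  3 ≤ length (v ∷ vs) × Unique (v ∷ vs) × Linked (Graph._~_ G) (v ∷ (vs ∷ʳ v))

Acyclic : {n : ℕ} → Graph n → Set
Acyclic G = ∀ v vs → ¬ IsCycle G v vs

IsTree : {n : ℕ} → Graph n → Set
IsTree G = Connected G × Acyclic G

IsComponent : {n : ℕ} → Graph n → Subset n → Set
IsComponent G C = ∃ λ v → v ∈ V G × (∀ u → u ∈ C ⇔ Reachable G v u)

record Expansion {n : ℕ} (t : ℕ) (F : Graph n) : Set₁ where
  open Graph F using (_~_)
  field
    T        : Fin t → Graph n
    T-tree   : ∀ s → IsTree (T s)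
    T⊆F      : ∀ s → T s ⊆ᴳ F
    disjoint : ∀ {s s′ v} → v ∈ V (T s) → v ∈ V (T s′) → s ≡ s′
    cover    : ∀ {v} → v ∈ V F → ∃ λ s → v ∈ V (T s)
    -- F has no edges inside V (T s) besides those of T s.
    inside   : ∀ {s u v} → u ∈ V (T s) → v ∈ V (T s) → u ~ v → Graph._~_ (T s) u v
    between  : ∀ {s s′} → s ≢ s′ →
               ∃! {A = Fin n × Fin n} _≡_ λ (u , v) → u ∈ V (T s) × v ∈ V (T s′) × u ~ v

IsOdd : {n t : ℕ} {F : Graph n} → Expansion t F → Set
IsOdd {n} {t} {F} E = Σ[ c ∈ (Fin n → Bool) ]
    (∀ s {u v} → Graph._~_ (T s) u v → c u ≢ c v)
  × (∀ {s s′ u v} → s ≢ s′ → u ∈ V (T s) → v ∈ V (T s′) → u ~ v → c u ≡ c v)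
  where
  open Expansion E
  open Graph F using (_~_)

HasOddKMinor : {n : ℕ} → ℕ → Graph n → Set₁
HasOddKMinor {n} t G =
  Σ[ F ∈ Graph n ] F ⊆ᴳ G × (Σ[ E ∈ Expansion t F ] IsOdd E)

-- Colorings are total on Fin n; the values outside V G are irrelevant, since
-- color classes are only ever used through induced subgraphs of G.
colorClass : {n k : ℕ} → (Fin n → Fin k) → Fin k → Subset n
colorClass c s = tabulate λ v → does (c v ≟ s)

IsMonochromaticComponent : {n k : ℕ} → Graph n → (Fin n → Fin k) → Subset n → Set
IsMonochromaticComponent G c C = ∃ λ s → IsComponent (induced G (colorClass c s)) C

{-# OPTIONS --safe #-}
module Submission where

-- The vertex set is partitioned into pieces, each with a spanning tree properly 2-coloured by the piece's own
-- colouring, and every piece gets one of t − 1 hues; a vertex is coloured by its hue and its colour in the piece.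
-- Let X be a connected part of what remains.  Inductively the earlier pieces adjacent to X are pairwise joined by
-- monochromatic edges, and every vertex of X adjacent to such a piece sees both of its colours.  Choose one vertex
-- of X next to each of these pieces.  A connected graph with k terminals has a subgraph containing them with a
-- properly 2-coloured spanning tree and clusters of size at most ⌈k/2⌉: at a cut vertex u, glue colourings of both
-- sides; when only terminals remain and none but the root is a cut vertex, add vertices one at a time.  Enlarge
-- this subgraph greedily until all other vertices of X adjacent to it see both of its colours.  The result is the
-- next piece: whichever colour a chosen vertex got, the earlier piece next to it has a neighbour of that colour.
-- With those earlier pieces it forms an odd clique expansion, so at most t − 2 of them are adjacent to X and some
-- hue is free.

open import Defs
open import Algebra.Properties.CommutativeSemigroup using (interchange)
open import Data.Bool.Base using (Bool; true; false; not)
open import Data.Bool.Properties using (not-¬) renaming (_≟_ to _≟ᵇ_)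
open import Data.Empty using (⊥; ⊥-elim)
open import Data.Fin.Base as Fin using (Fin; inject≤)
open import Data.Fin.Properties
  using (_≟_; any?; all?; pigeonhole; <⇒≢; <-cmp; _<?_; toℕ-inject≤; combine-injective)
open import Data.Fin.Subset using (Subset; ∣_∣; _∈_; _∉_; _⊆_; _⊂_; _∩_; _∪_; ∁; ⁅_⁆; inside; outside)
  renaming (⊥ to ⊥ˢ)
open import Data.Fin.Subset.Properties
open import Data.List.Base using (List; []; _∷_; length; map; filter; lookup; _∷ʳ_)
open import Data.List.Properties using (length-map)
open import Data.List.Membership.Propositional using () renaming (_∈_ to _∈ₗ_; _∉_ to _∉ₗ_)
import Data.List.Membership.DecPropositional as Listᵐ
open import Data.List.Membership.Propositional.Properties using (∈-filter⁺; ∈-filter⁻; ∈-map⁺; ∈-lookup)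
open import Data.List.Membership.Setoid.Properties using (index-injective)
open import Data.List.Relation.Unary.All as All using (All; []; _∷_)
open import Data.List.Relation.Unary.All.Properties using (all-filter)
open import Data.List.Relation.Unary.AllPairs using (AllPairs; []; _∷_)
import Data.List.Relation.Unary.AllPairs.Properties as AllPairs
open import Data.List.Relation.Unary.Linked using (Linked; _∷_)
open import Data.List.Relation.Unary.Unique.Propositional using (Unique)
open import Data.List.Relation.Unary.Any using (here; there; index)
open import Data.Nat.Base using (ℕ; zero; suc; _+_; _*_; _∸_; _⊔_; _≤_; _<_; z≤n; s≤s; ⌊_/2⌋; ⌈_/2⌉)
open import Data.Nat.Induction using (Acc; acc; <-wellFounded)
open import Data.Nat.Properties as ℕ using (module ≤-Reasoning)
open import Data.Product using (Σ-syntax; ∃; ∃₂; ∃!; _×_; _,_; proj₁; proj₂; map₂; swap)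
open import Data.Product.Properties using (≡-dec)
open import Data.Sum using (_⊎_; inj₁; inj₂; [_,_]′)
open import Data.Vec.Base using ([]; _∷_; tabulate)
open import Data.Vec.Properties using (lookup⇒[]=; []=⇒lookup; lookup∘tabulate)
open import Data.Vec.Functional using (updateAt)
open import Data.Vec.Functional.Properties using (updateAt-updates; updateAt-minimal)
open import Function.Base using (_∘_; const; id)
open import Function.Bundles using (module Equivalence)
open import Function.Definitions using (Injective)
open import Relation.Binary.Construct.Closure.ReflexiveTransitive as Star using (Star; ε; _◅_; _◅◅_)
open import Relation.Binary.PropositionalEquality
open import Relation.Nullary using (¬_; Dec; yes; no; contradiction)
open import Relation.Nullary.Decidable
  using (_×-dec_; _⊎-dec_; _→-dec_; ¬?; decidable-stable; map′; does; dec-true; dec-false)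
open import Relation.Binary.Definitions using (tri<; tri≈; tri>)
open Equivalence using (to; from)

-- Finite sets and lists

+-interchange : ∀ a b c d → (a + b) + (c + d) ≡ (a + c) + (b + d)
+-interchange = interchange ℕ.+-commutativeSemigroup

infixl 8 _∖_

_∖_ : {n : ℕ} → Subset n → Subset n → Subset n
A ∖ B = A ∩ ∁ B

module _ {n : ℕ} {A B : Subset n} {x : Fin n} where

  ∈∖⁺ : x ∈ A → x ∉ B → x ∈ A ∖ B
  ∈∖⁺ x∈A x∉B = x∈p∩q⁺ (x∈A , x∉p⇒x∈∁p x∉B)

  ∈∖⁻ : x ∈ A ∖ B → x ∈ A × x ∉ B
  ∈∖⁻ x∈ = map₂ x∈∁p⇒x∉p (x∈p∩q⁻ A (∁ B) x∈)

  ∈∩⁺ : x ∈ A → x ∈ B → x ∈ A ∩ B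
  ∈∩⁺ x∈A x∈B = x∈p∩q⁺ (x∈A , x∈B)

  ∈∩⁻ : x ∈ A ∩ B → x ∈ A × x ∈ B
  ∈∩⁻ = x∈p∩q⁻ A B

  ∈∪⁻ : x ∈ A ∪ B → x ∈ A ⊎ x ∈ B
  ∈∪⁻ = x∈p∪q⁻ A B

  ∈∪ˡ : x ∈ A → x ∈ A ∪ B
  ∈∪ˡ = p⊆p∪q B

  ∈∪ʳ : x ∈ B → x ∈ A ∪ B
  ∈∪ʳ = q⊆p∪q A B

module _ {n : ℕ} {A : Subset n} {x y : Fin n} where

  ∈∪⁅⁆⁻ : x ∈ A ∪ ⁅ y ⁆ → x ∈ A ⊎ x ≡ y
  ∈∪⁅⁆⁻ x∈ with ∈∪⁻ x∈
  ... | inj₁ x∈A = inj₁ x∈A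
  ... | inj₂ x∈y = inj₂ (x∈⁅y⁆⇒x≡y y x∈y)

  ∈∖⁅⁆⁺ : x ∈ A → x ≢ y → x ∈ A ∖ ⁅ y ⁆
  ∈∖⁅⁆⁺ x∈A x≢y = ∈∖⁺ x∈A (x≢y⇒x∉⁅y⁆ x≢y)

  ∈∖⁅⁆⁻ : x ∈ A ∖ ⁅ y ⁆ → x ∈ A × x ≢ y
  ∈∖⁅⁆⁻ = map₂ x∉⁅y⁆⇒x≢y ∘ ∈∖⁻

∣∩∣+∣∖∣ : ∀ {n} (A B : Subset n) → ∣ A ∩ B ∣ + ∣ A ∖ B ∣ ≡ ∣ A ∣
∣∩∣+∣∖∣ []            []            = refl
∣∩∣+∣∖∣ (outside ∷ A) (_       ∷ B) = ∣∩∣+∣∖∣ A B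
∣∩∣+∣∖∣ (inside  ∷ A) (inside  ∷ B) = cong suc (∣∩∣+∣∖∣ A B)
∣∩∣+∣∖∣ (inside  ∷ A) (outside ∷ B) = trans (ℕ.+-suc _ _) (cong suc (∣∩∣+∣∖∣ A B))

∣∖∣< : ∀ {n} {A B : Subset n} {x} → x ∈ A → x ∈ B → ∣ A ∖ B ∣ < ∣ A ∣
∣∖∣< {A = A} {B} {x} x∈A x∈B =
  p⊂q⇒∣p∣<∣q∣ {p = A ∖ B} {q = A} (proj₁ ∘ ∈∖⁻ , x , x∈A , λ x∈ → proj₂ (∈∖⁻ {A = A} x∈) x∈B)

∣∪⁅⁆∣≤ : ∀ {n} (A : Subset n) y → ∣ A ∪ ⁅ y ⁆ ∣ ≤ suc ∣ A ∣
∣∪⁅⁆∣≤ A y = begin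
  ∣ A ∪ ⁅ y ⁆ ∣                                       ≡⟨ ∣∩∣+∣∖∣ (A ∪ ⁅ y ⁆) ⁅ y ⁆ ⟨
  ∣ (A ∪ ⁅ y ⁆) ∩ ⁅ y ⁆ ∣ + ∣ (A ∪ ⁅ y ⁆) ∖ ⁅ y ⁆ ∣   ≤⟨ ℕ.+-mono-≤ (∣p∩q∣≤∣q∣ (A ∪ ⁅ y ⁆) ⁅ y ⁆) (p⊆q⇒∣p∣≤∣q∣ rest) ⟩
  ∣ ⁅ y ⁆ ∣ + ∣ A ∣                                   ≡⟨ cong (_+ ∣ A ∣) (∣⁅x⁆∣≡1 y) ⟩
  suc ∣ A ∣                                           ∎
  where
  open ≤-Reasoning
  rest : (A ∪ ⁅ y ⁆) ∖ ⁅ y ⁆ ⊆ A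
  rest x∈ with ∈∖⁅⁆⁻ x∈
  ... | x∈∪ , x≢y with ∈∪⁅⁆⁻ x∈∪
  ... | inj₁ x∈A = x∈A
  ... | inj₂ x≡y = contradiction x≡y x≢y

abstract
  fresh : ∀ {h} (xs : List (Fin h)) → length xs < h → ∃ (_∉ₗ xs)
  fresh xs ∣xs∣<h with any? (λ x → ¬? (Listᵐ._∈?_ _≟_ x xs))
  ... | yes found = found
  ... | no ¬found with pigeonhole ∣xs∣<h (index ∘ member)
    where
    member : ∀ x → x ∈ₗ xs
    member x = decidable-stable (Listᵐ._∈?_ _≟_ x xs) λ x∉xs → ¬found (x , x∉xs)
  ... | i , j , i<j , eq = contradiction (index-injective (setoid _) _ _ eq) (<⇒≢ i<j)

∈-tabulate⁺ : ∀ {n} {P : Fin n → Set} (P? : ∀ x → Dec (P x)) {x} → P x → x ∈ tabulate (does ∘ P?)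
∈-tabulate⁺ P? {x} Px = lookup⇒[]= x _ (trans (lookup∘tabulate (does ∘ P?) x) (dec-true (P? x) Px))

∈-tabulate⁻ : ∀ {n} {P : Fin n → Set} (P? : ∀ x → Dec (P x)) {x} → x ∈ tabulate (does ∘ P?) → P x
∈-tabulate⁻ P? {x} x∈ = decidable-stable (P? x) λ ¬Px →
  contradiction (trans (sym ([]=⇒lookup x∈)) (trans (lookup∘tabulate (does ∘ P?) x) (dec-false (P? x) ¬Px))) λ ()

AllPairs-lookup : ∀ {A : Set} {R : A → A → Set} {xs} → AllPairs R xs →
  ∀ {i j} → i Fin.< j → R (lookup xs i) (lookup xs j)
AllPairs-lookup (Rx ∷ Rxs) {Fin.zero}  {Fin.suc j} _         = All.lookup Rx (∈-lookup j)
AllPairs-lookup (Rx ∷ Rxs) {Fin.suc i} {Fin.suc j} (s≤s i<j) = AllPairs-lookup Rxs i<j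

-- Neighbours along a cycle

TwoNeighbours : {A : Set} → (A → A → Set) → List A → Set
TwoNeighbours R L = ∀ {x} → x ∈ₗ L → ∃₂ λ y z → y ≢ z × y ∈ₗ L × z ∈ₗ L × R x y × R x z

module _ {A : Set} {R : A → A → Set} (R-sym : ∀ {x y} → R x y → R y x) where

  -- An inner vertex x of a walk a, bs, e can fail to have two distinct neighbours only if bs = [x] and a ≡ e.
  walk-two-neighbours : ∀ {a bs e} → Linked R (a ∷ (bs ∷ʳ e)) → Unique (a ∷ bs) → All (e ≢_) bs →
    ∀ {x} → x ∈ₗ bs → ∃₂ λ y z → (y ≢ z ⊎ (y ≡ a × z ≡ e × length bs ≡ 1)) ×
      y ∈ₗ a ∷ bs × z ∈ₗ e ∷ bs × R x y × R x z
  walk-two-neighbours {a} {b ∷ []} {e} (Rab ∷ Rbe ∷ _) _ _ (here refl) =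
    a , e , inj₂ (refl , refl , refl) , here refl , here refl , R-sym Rab , Rbe
  walk-two-neighbours {a} {b ∷ b′ ∷ bs} (Rab ∷ Rbb′ ∷ _) ((_ ∷ a≢b′ ∷ _) ∷ _) _ (here refl) =
    a , b′ , inj₁ a≢b′ , here refl , there (there (here refl)) , R-sym Rab , Rbb′
  walk-two-neighbours {a} {b ∷ bs} {e} (_ ∷ linked) (_ ∷ unique) (e≢b ∷ e∉bs) (there x∈bs)
    with walk-two-neighbours linked unique e∉bs x∈bs
  ... | y , z , y≢z , y∈ , z∈ , Rxy , Rxz = y , z , inj₁ (distinct y≢z) , there y∈ , shift z∈ , Rxy , Rxz
    where
    distinct : y ≢ z ⊎ (y ≡ b × z ≡ e × length bs ≡ 1) → y ≢ z
    distinct (inj₁ y≢z)             = y≢z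
    distinct (inj₂ (y≡b , z≡e , _)) y≡z = e≢b (trans (sym z≡e) (trans (sym y≡z) y≡b))
    shift : ∀ {z} → z ∈ₗ e ∷ bs → z ∈ₗ e ∷ b ∷ bs
    shift (here z≡e) = here z≡e
    shift (there z∈) = there (there z∈)

  walk-end : ∀ {a b bs e} → Linked R (a ∷ (b ∷ bs) ∷ʳ e) → ∃ λ z → z ∈ₗ b ∷ bs × R z e
  walk-end {bs = []}    (_ ∷ Rbe ∷ _) = _ , here refl , Rbe
  walk-end {bs = _ ∷ _} (_ ∷ linked)  = let z , z∈ , Rze = walk-end linked in z , there z∈ , Rze

  -- Cycles enter the proof only through this consequence, which suits induction over leaves. The
  -- base vertex has its successor and the last vertex. All others are inner vertices of a walk from
  -- `v` to `v`, and length at least three rules out the exceptional case of `walk-two-neighbours`.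
  cycle-two-neighbours : ∀ {v vs} → 3 ≤ length (v ∷ vs) → Unique (v ∷ vs) → Linked R (v ∷ (vs ∷ʳ v)) →
    TwoNeighbours R (v ∷ vs)
  cycle-two-neighbours {v} {b ∷ b′ ∷ bs} _ (_ ∷ (b∉ ∷ _)) (Rvb ∷ linked) (here refl) =
    let z , z∈ , Rzv = walk-end linked in
    b , z , All.lookup b∉ z∈ , there (here refl) , there (there z∈) , Rvb , R-sym Rzv
  cycle-two-neighbours {v} {b ∷ b′ ∷ bs} _ unique@(v∉ ∷ _) linked (there x∈)
    with walk-two-neighbours linked unique v∉ x∈
  ... | y , z , inj₁ y≢z           , rest = y , z , y≢z , rest
  ... | y , z , inj₂ (_ , _ , ()) , rest
  cycle-two-neighbours {v} {[]}    (s≤s ())       _ _ _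
  cycle-two-neighbours {v} {_ ∷ []} (s≤s (s≤s ())) _ _ _

module _ {n : ℕ} (G : Graph n) where
  open Graph G using (_~_; _~?_; ~-sym; ~-irrefl; ~⇒∈V)

  -- Connectivity of vertex sets in terms of cuts

  Crossed : Subset n → Subset n → Set
  Crossed A D = ∃₂ λ a b → (a ∈ A × a ∈ D) × (b ∈ A × b ∉ D) × a ~ b

  crossed? : ∀ A D → Dec (Crossed A D)
  crossed? A D = any? λ a → any? λ b →
    ((a ∈? A) ×-dec (a ∈? D)) ×-dec ((b ∈? A) ×-dec ¬? (b ∈? D)) ×-dec (a ~? b)

  -- Connectivity of G[A]; the empty set counts as connected.
  Conn : Subset n → Set
  Conn A = ∀ D {x y} → x ∈ A → x ∈ D → y ∈ A → y ∉ D → Crossed A D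

  Split : Subset n → Subset n → Set
  Split A D = (∃ λ x → x ∈ A × x ∈ D) × (∃ λ y → y ∈ A × y ∉ D) × ¬ Crossed A D

  split? : ∀ A → Dec (∃ (Split A))
  split? A = anySubset? λ D →
    any? (λ x → (x ∈? A) ×-dec (x ∈? D)) ×-dec
    any? (λ y → (y ∈? A) ×-dec ¬? (y ∈? D)) ×-dec
    ¬? (crossed? A D)

  ¬split⇒conn : ∀ {A} → ¬ ∃ (Split A) → Conn A
  ¬split⇒conn {A} ¬split D x∈A x∈D y∈A y∉D = decidable-stable (crossed? A D)
    λ ¬crossed → ¬split (D , (_ , x∈A , x∈D) , (_ , y∈A , y∉D) , ¬crossed)

  conn? : ∀ A → Dec (Conn A)
  conn? A with split? A
  ... | no ¬split = yes (¬split⇒conn ¬split)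
  ... | yes (D , (x , x∈A , x∈D) , (y , y∈A , y∉D) , ¬crossed) =
    no λ conn → ¬crossed (conn D x∈A x∈D y∈A y∉D)

  -- Apply connectivity of `A` to `D ∩ Z` or to `Z ∖ D`, whichever misses `u`. The edge found cannot
  -- leave `Z`, as it would then start at `u`; so it crosses `D` within `A ∩ Z`.
  conn-∩ : ∀ {A Z u} → Conn A →
    (∀ {a b} → a ∈ A → a ∈ Z → b ∈ A → b ∉ Z → a ~ b → a ≡ u) → Conn (A ∩ Z)
  conn-∩ {A} {Z} {u} conn only-u D x∈ x∈D y∈ y∉D with ∈∩⁻ x∈ | ∈∩⁻ y∈ | u ∈? D
  ... | x∈A , x∈Z | y∈A , y∈Z | no u∉D
    with conn (D ∩ Z) x∈A (∈∩⁺ x∈D x∈Z) y∈A (y∉D ∘ proj₁ ∘ ∈∩⁻)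
  ... | a , b , (a∈A , a∈) , (b∈A , b∉) , a~b with ∈∩⁻ a∈ | b ∈? Z
  ... | a∈D , a∈Z | yes b∈Z =
    a , b , (∈∩⁺ a∈A a∈Z , a∈D) , (∈∩⁺ b∈A b∈Z , λ b∈D → b∉ (∈∩⁺ b∈D b∈Z)) , a~b
  ... | a∈D , a∈Z | no b∉Z =
    contradiction (subst (_∈ D) (only-u a∈A a∈Z b∈A b∉Z a~b) a∈D) u∉D
  conn-∩ {A} {Z} {u} conn only-u D x∈ x∈D y∈ y∉D
      | x∈A , x∈Z | y∈A , y∈Z | yes u∈D
    with conn (Z ∖ D) y∈A (∈∖⁺ y∈Z y∉D) x∈A (λ x∈∖ → proj₂ (∈∖⁻ x∈∖) x∈D)
  ... | a , b , (a∈A , a∈) , (b∈A , b∉) , a~b with ∈∖⁻ a∈ | b ∈? Z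
  ... | a∈Z , a∉D | yes b∈Z =
    b , a , (∈∩⁺ b∈A b∈Z , decidable-stable (b ∈? D) (b∉ ∘ ∈∖⁺ b∈Z)) , (∈∩⁺ a∈A a∈Z , a∉D) , ~-sym a~b
  ... | a∈Z , a∉D | no b∉Z =
    contradiction (subst (_∈ D) (sym (only-u a∈A a∈Z b∈A b∉Z a~b)) u∈D) a∉D

  -- Monochromatic clusters and properly coloured spanning trees

  Mono : {K : Set} → (Fin n → K) → Subset n → Set
  Mono c Y = ∀ {x y} → x ∈ Y → y ∈ Y → c x ≡ c y

  mono-cong : ∀ {K : Set} {c c′ : Fin n → K} {Y} →
    (∀ {x} → x ∈ Y → c x ≡ c′ x) → Mono c Y → Mono c′ Y
  mono-cong c≗c′ mono x∈Y y∈Y = trans (sym (c≗c′ x∈Y)) (trans (mono x∈Y y∈Y) (c≗c′ y∈Y))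

  mono? : ∀ (c : Fin n → Bool) Y → Dec (Mono c Y)
  mono? c Y = map′ (λ m x∈ y∈ → m _ _ x∈ y∈) (λ m _ _ x∈ y∈ → m x∈ y∈)
    (all? λ x → all? λ y → (x ∈? Y) →-dec (y ∈? Y) →-dec (c x ≟ᵇ c y))

  -- Quantifying over all connected monochromatic sets instead of maximal ones lets the bound be
  -- applied to parts of a cluster.
  Small : {K : Set} → (Subset n → Set) → (Fin n → K) → Subset n → Set
  Small B c H = ∀ Y → Y ⊆ H → Conn Y → Mono c Y → B Y

  -- A spanning tree of H with root r, grown leaf by leaf and properly coloured by c.
  data Grow (c : Fin n → Bool) (r : Fin n) : Subset n → Set where
    root : Grow c r ⁅ r ⁆
    leaf : ∀ {H p v} → Grow c r H → p ∈ H → v ∉ H → p ~ v → c p ≢ c v → Grow c r (H ∪ ⁅ v ⁆)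

  grow-root : ∀ {c r H} → Grow c r H → r ∈ H
  grow-root root             = x∈⁅x⁆ _
  grow-root (leaf g _ _ _ _) = ∈∪ˡ (grow-root g)

  grow-cong : ∀ {c c′ r H} → (∀ {x} → x ∈ H → c x ≡ c′ x) → Grow c r H → Grow c′ r H
  grow-cong eq root = root
  grow-cong eq (leaf g p∈H v∉H p~v p≢v) =
    leaf (grow-cong (eq ∘ ∈∪ˡ) g) p∈H v∉H p~v
      λ p≡v → p≢v (trans (eq (∈∪ˡ p∈H)) (trans p≡v (sym (eq (∈∪ʳ (x∈⁅x⁆ _))))))

  -- The leaves of the second tree are added to the first in their original order. Such a leaf is
  -- new to `S`: otherwise it would equal `u`, the root of the second tree, which was there from the
  -- start.
  grow-++ : ∀ {c r u S H} → Grow c r S → u ∈ S → Grow c u H →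
    (∀ {x} → x ∈ H → x ∈ S → x ≡ u) → Grow c r (S ∪ H)
  grow-++ {c} {r} {u} {S} g u∈S root _ = subst (Grow c r) (⊆-antisym ∈∪ˡ absorb) g
    where
    absorb : S ∪ ⁅ u ⁆ ⊆ S
    absorb x∈ with ∈∪⁅⁆⁻ x∈
    ... | inj₁ x∈S  = x∈S
    ... | inj₂ refl = u∈S
  grow-++ {c} {r} {u} {S} g u∈S (leaf {H} {p} {v} h p∈H v∉H p~v p≢v) meet =
    subst (Grow c r) (∪-assoc S H ⁅ v ⁆)
      (leaf (grow-++ g u∈S h (meet ∘ ∈∪ˡ)) (∈∪ʳ p∈H) v∉S∪H p~v p≢v)
    where
    v∉S∪H : v ∉ S ∪ H
    v∉S∪H v∈ with ∈∪⁻ v∈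
    ... | inj₂ v∈H = v∉H v∈H
    ... | inj₁ v∈S = v∉H (subst (_∈ H) (sym (meet (∈∪ʳ (x∈⁅x⁆ v)) v∈S)) (grow-root h))

  module _ (c : Fin n → Bool) (v : Fin n) (β : Bool) where

    recolour : Fin n → Bool
    recolour = updateAt c v (const β)

    recolour-new : recolour v ≡ β
    recolour-new = updateAt-updates v c

    recolour-old : ∀ {x} → x ≢ v → c x ≡ recolour x
    recolour-old {x} x≢v = sym (updateAt-minimal x v c x≢v)

    module _ {H : Subset n} (v∉H : v ∉ H) where

      recolour-∈ : ∀ {x} → x ∈ H → c x ≡ recolour x
      recolour-∈ x∈H = recolour-old λ { refl → v∉H x∈H }

      attach : ∀ {r p} → Grow c r H → p ∈ H → p ~ v → c p ≢ β → Grow recolour r (H ∪ ⁅ v ⁆)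
      attach g p∈H p~v p≢β = leaf (grow-cong recolour-∈ g) p∈H v∉H p~v
        λ p≡v → p≢β (trans (recolour-∈ p∈H) (trans p≡v recolour-new))

      attach-small : ∀ {B} → Small B c H →
        (∀ Y → Y ⊆ H ∪ ⁅ v ⁆ → v ∈ Y → Conn Y → Mono recolour Y → B Y) →
        Small B recolour (H ∪ ⁅ v ⁆)
      attach-small small new Y Y⊆ conn mono with v ∈? Y
      ... | yes v∈Y = new Y Y⊆ v∈Y conn mono
      ... | no  v∉Y = small Y Y⊆H conn (mono-cong (sym ∘ recolour-∈ ∘ Y⊆H) mono)
        where
        Y⊆H : Y ⊆ H
        Y⊆H x∈Y with ∈∪⁅⁆⁻ (Y⊆ x∈Y)
        ... | inj₁ x∈H  = x∈H
        ... | inj₂ refl = contradiction x∈Y v∉Y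

      -- A larger `Y` would, being connected, contain an edge from `v` to a vertex of `H` of the
      -- same colour `β`.
      isolated : (∀ {y} → y ∈ H → v ~ y → c y ≢ β) →
        ∀ Y → Y ⊆ H ∪ ⁅ v ⁆ → v ∈ Y → Conn Y → Mono recolour Y → Y ≡ ⁅ v ⁆
      isolated other Y Y⊆ v∈Y conn mono = ⊆-antisym Y⊆v λ x∈ → subst (_∈ Y) (sym (x∈⁅y⁆⇒x≡y v x∈)) v∈Y
        where
        Y⊆v : Y ⊆ ⁅ v ⁆
        Y⊆v {y} y∈Y = decidable-stable (y ∈? ⁅ v ⁆) λ y∉v →
          let a , b , (a∈Y , a∈v) , (b∈Y , b∉v) , a~b = conn ⁅ v ⁆ v∈Y (x∈⁅x⁆ v) y∈Y y∉v
              b∈H = [ id , (λ b≡v → contradiction (subst (_∈ ⁅ v ⁆) (sym b≡v) (x∈⁅x⁆ v)) b∉v) ]′ (∈∪⁅⁆⁻ (Y⊆ b∈Y))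
          in other b∈H (subst (_~ b) (x∈⁅y⁆⇒x≡y v a∈v) a~b)
               (trans (recolour-∈ b∈H) (trans (mono b∈Y v∈Y) recolour-new))

  -- Coloured subtrees through prescribed terminals

  -- Clusters of size at most ⌈(k + 1)/2⌉, and ⌈k/2⌉ at the root r; here k counts the terminals besides r.
  -- The stronger bound at the root is what lets two sides be glued at a cut vertex.
  Bound : ℕ → Fin n → Subset n → Set
  Bound k r Y = (∣ Y ∣ + ∣ Y ∣ ≤ 2 + k) × (r ∈ Y → ∣ Y ∣ + ∣ Y ∣ ≤ 1 + k)

  bound? : ∀ k r Y → Dec (Bound k r Y)
  bound? k r Y = (∣ Y ∣ + ∣ Y ∣ ℕ.≤? 2 + k) ×-dec ((r ∈? Y) →-dec (∣ Y ∣ + ∣ Y ∣ ℕ.≤? 1 + k))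

  -- A singleton at the root needs `2 ≤ 1 + k`, so `k` must be positive.
  bound-⁅⁆ : ∀ {k r v} → 1 ≤ k → Bound k r ⁅ v ⁆
  bound-⁅⁆ {k} {r} {v} 1≤k rewrite ∣⁅x⁆∣≡1 v = ℕ.m≤m+n 2 k , λ _ → s≤s 1≤k

  -- `W` holds the terminals and may reach outside `A`. The root colour `β` is prescribed so that,
  -- at a cut vertex, the colour obtained on one side can be imposed on the other.
  record Cell (A W : Subset n) (r : Fin n) (β : Bool) (k : ℕ) : Set where
    field
      H      : Subset n
      c      : Fin n → Bool
      tree   : Grow c r H
      cr≡β   : c r ≡ β
      H⊆A    : H ⊆ A
      W∩A⊆H  : ∀ {x} → x ∈ W → x ∈ A → x ∈ H
      small  : Small (Bound k r) c H

  singleton-cell : ∀ {A W r β k} → 1 ≤ k → r ∈ A → (∀ {x} → x ∈ A → x ≡ r) → Cell A W r β k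
  singleton-cell {A} {W} {r} {β} {k} 1≤k r∈A A⊆r = record
    { H     = ⁅ r ⁆
    ; c     = const β
    ; tree  = root
    ; cr≡β  = refl
    ; H⊆A   = λ x∈ → subst (_∈ A) (sym (x∈⁅y⁆⇒x≡y r x∈)) r∈A
    ; W∩A⊆H = λ _ x∈A → subst (_∈ ⁅ r ⁆) (sym (A⊆r x∈A)) (x∈⁅x⁆ r)
    ; small = λ Y Y⊆ _ _ → small-sub Y⊆
    }
    where
    small-sub : ∀ {Y} → Y ⊆ ⁅ r ⁆ → Bound k r Y
    small-sub Y⊆ = let m = ℕ.≤-trans (p⊆q⇒∣p∣≤∣q∣ Y⊆) (ℕ.≤-reflexive (∣⁅x⁆∣≡1 r)) in
      ℕ.≤-trans (ℕ.+-mono-≤ m m) (ℕ.m≤m+n 2 k) , λ _ → ℕ.≤-trans (ℕ.+-mono-≤ m m) (s≤s 1≤k)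

  -- Cut vertices and gluing

  Via : Fin n → Subset n → Subset n → Set
  Via u D A = ∀ {a b} → a ∈ A → a ∈ D → b ∈ A → b ∉ D → a ~ b → b ≡ u

  conn-outer : ∀ {A D u} → Conn A → Via u D A → Conn (A ∖ D)
  conn-outer conn via-u = conn-∩ conn λ a∈A a∈∁D b∈A b∉∁D a~b →
    via-u b∈A (x∉∁p⇒x∈p b∉∁D) a∈A (x∈∁p⇒x∉p a∈∁D) (~-sym a~b)

  conn-inner : ∀ {A D u} → Conn A → Via u D A → Conn (A ∩ (D ∪ ⁅ u ⁆))
  conn-inner {A} {D} {u} conn via-u = conn-∩ conn only-u
    where
    only-u : ∀ {a b} → a ∈ A → a ∈ D ∪ ⁅ u ⁆ → b ∈ A → b ∉ D ∪ ⁅ u ⁆ → a ~ b → a ≡ u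
    only-u a∈A a∈ b∈A b∉ a~b with ∈∪⁅⁆⁻ a∈
    ... | inj₂ a≡u = a≡u
    ... | inj₁ a∈D with refl ← via-u a∈A a∈D b∈A (b∉ ∘ ∈∪ˡ) a~b = contradiction (∈∪ʳ (x∈⁅x⁆ u)) b∉

  -- Within `A`, the set `D` is a nonempty union of components of `A` minus `u`, none of them
  -- containing `r`.
  record Cut (A : Subset n) (r u : Fin n) (D : Subset n) : Set where
    field
      r∉D   : r ∉ D
      u∉D   : u ∉ D
      inner : ∃ λ x → x ∈ A × x ∈ D
      via-u : Via u D A

  split⇒cut : ∀ {A r u} → ∃ (Split (A ∖ ⁅ u ⁆)) → ∃ (Cut A r u)
  split⇒cut {A} {r} {u} (D , (x , x∈ , x∈D) , (y , y∈ , y∉D) , ¬crossed) with r ∈? D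
  ... | no r∉D = D ∖ ⁅ u ⁆ , record
    { r∉D   = r∉D ∘ proj₁ ∘ ∈∖⁅⁆⁻
    ; u∉D   = λ u∈ → proj₂ (∈∖⁅⁆⁻ u∈) refl
    ; inner = x , proj₁ (∈∖⁅⁆⁻ x∈) , ∈∖⁅⁆⁺ x∈D (proj₂ (∈∖⁅⁆⁻ x∈))
    ; via-u = λ {a} {b} a∈A a∈ b∈A b∉ a~b → decidable-stable (b ≟ u) λ b≢u →
        let a∈D , a≢u = ∈∖⁅⁆⁻ a∈ in
        ¬crossed (a , b , (∈∖⁅⁆⁺ a∈A a≢u , a∈D) , (∈∖⁅⁆⁺ b∈A b≢u , λ b∈D → b∉ (∈∖⁅⁆⁺ b∈D b≢u)) , a~b)
    }
  -- The root lies in `D`, so the opposite side is taken. In both cases `u` is removed, since a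
  -- split of `A ∖ ⁅ u ⁆` says nothing about `u` itself.
  ... | yes r∈D = ∁ D ∖ ⁅ u ⁆ , record
    { r∉D   = λ r∈ → x∈∁p⇒x∉p (proj₁ (∈∖⁅⁆⁻ r∈)) r∈D
    ; u∉D   = λ u∈ → proj₂ (∈∖⁅⁆⁻ u∈) refl
    ; inner = y , proj₁ (∈∖⁅⁆⁻ y∈) , ∈∖⁅⁆⁺ (x∉p⇒x∈∁p y∉D) (proj₂ (∈∖⁅⁆⁻ y∈))
    ; via-u = λ {a} {b} a∈A a∈ b∈A b∉ a~b → decidable-stable (b ≟ u) λ b≢u →
        let a∈∁D , a≢u = ∈∖⁅⁆⁻ a∈ in
        ¬crossed (b , a ,
          (∈∖⁅⁆⁺ b∈A b≢u , x∉∁p⇒x∈p λ b∈∁D → b∉ (∈∖⁅⁆⁺ b∈∁D b≢u)) ,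
          (∈∖⁅⁆⁺ a∈A a≢u , x∈∁p⇒x∉p a∈∁D) , ~-sym a~b)
    }

  module _ {A W : Subset n} {r : Fin n} {β : Bool} {k : ℕ} where

    open Cell

    -- On the root side `u` becomes an extra terminal, hence the `suc k`; its colour there is
    -- imposed on the root of the far side. The two trees share only `u`, and a cluster missing `u`
    -- stays on one side.
    glue : ∀ {u D k₁ k₂} → Cut A r u D → k₁ + k₂ ≡ suc k → 1 ≤ k₁ → k₁ ≤ k → u ∈ A →
      (C₂ : Cell (A ∖ D) (W ∖ D ∪ ⁅ u ⁆) r β k₂) →
      Cell (A ∩ (D ∪ ⁅ u ⁆)) (W ∩ D) u (c C₂ u) k₁ → Cell A W r β k
    glue {u} {D} {k₁} {k₂} cut k₁+k₂≡1+k 1≤k₁ k₁≤k u∈A C₂ C₁ = record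
      { H     = H C₂ ∪ H C₁
      ; c     = col
      ; tree  = grow-++ (grow-cong col₂ (tree C₂)) u∈H₂ (grow-cong col₁ (tree C₁)) meet
      ; cr≡β  = trans (sym (col₂ (grow-root (tree C₂)))) (cr≡β C₂)
      ; H⊆A   = inA
      ; W∩A⊆H = W∩A⊆
      ; small = sm
      }
      where
      open Cut cut

      col : Fin n → Bool
      col x with x ∈? D
      ... | yes _ = c C₁ x
      ... | no  _ = c C₂ x

      u∈H₂ : u ∈ H C₂
      u∈H₂ = W∩A⊆H C₂ (∈∪ʳ (x∈⁅x⁆ u)) (∈∖⁺ u∈A u∉D)

      col₂ : ∀ {x} → x ∈ H C₂ → c C₂ x ≡ col x
      col₂ {x} x∈H₂ with x ∈? D
      ... | yes x∈D = contradiction x∈D (proj₂ (∈∖⁻ (H⊆A C₂ x∈H₂)))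
      ... | no  _   = refl

      H₁⊆ : ∀ {x} → x ∈ H C₁ → x ∈ D ⊎ x ≡ u
      H₁⊆ = ∈∪⁅⁆⁻ ∘ proj₂ ∘ ∈∩⁻ ∘ H⊆A C₁

      col₁ : ∀ {x} → x ∈ H C₁ → c C₁ x ≡ col x
      col₁ {x} x∈H₁ with x ∈? D | H₁⊆ x∈H₁
      ... | yes _   | _         = refl
      ... | no  x∉D | inj₁ x∈D  = contradiction x∈D x∉D
      ... | no  _   | inj₂ refl = cr≡β C₁

      meet : ∀ {x} → x ∈ H C₁ → x ∈ H C₂ → x ≡ u
      meet x∈H₁ x∈H₂ with H₁⊆ x∈H₁
      ... | inj₁ x∈D = contradiction x∈D (proj₂ (∈∖⁻ (H⊆A C₂ x∈H₂)))
      ... | inj₂ x≡u = x≡u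

      W∩A⊆ : ∀ {x} → x ∈ W → x ∈ A → x ∈ H C₂ ∪ H C₁
      W∩A⊆ {x} x∈W x∈A with x ∈? D
      ... | yes x∈D = ∈∪ʳ (W∩A⊆H C₁ (∈∩⁺ x∈W x∈D) (∈∩⁺ x∈A (∈∪ˡ x∈D)))
      ... | no  x∉D = ∈∪ˡ (W∩A⊆H C₂ (∈∪ˡ (∈∖⁺ x∈W x∉D)) (∈∖⁺ x∈A x∉D))

      inA : ∀ {x} → x ∈ H C₂ ∪ H C₁ → x ∈ A
      inA = [ proj₁ ∘ ∈∖⁻ ∘ H⊆A C₂ , proj₁ ∘ ∈∩⁻ ∘ H⊆A C₁ ]′ ∘ ∈∪⁻

      to₁ : ∀ {x} → x ∈ H C₂ ∪ H C₁ → x ∈ D → x ∈ H C₁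
      to₁ x∈ x∈D with ∈∪⁻ x∈
      ... | inj₁ x∈H₂ = contradiction x∈D (proj₂ (∈∖⁻ (H⊆A C₂ x∈H₂)))
      ... | inj₂ x∈H₁ = x∈H₁

      to₂ : ∀ {x} → x ∈ H C₂ ∪ H C₁ → x ∉ D → x ∈ H C₂
      to₂ x∈ x∉D with ∈∪⁻ x∈
      ... | inj₁ x∈H₂ = x∈H₂
      ... | inj₂ x∈H₁ with H₁⊆ x∈H₁
      ... | inj₁ x∈D  = contradiction x∈D x∉D
      ... | inj₂ refl = u∈H₂

      k₂≤k : k₂ ≤ k
      k₂≤k = ℕ.+-cancelˡ-≤ 1 k₂ k (ℕ.≤-trans (ℕ.+-monoˡ-≤ k₂ 1≤k₁) (ℕ.≤-reflexive k₁+k₂≡1+k))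

      sm : Small (Bound k r) col (H C₂ ∪ H C₁)
      sm Y Y⊆ conn mono with u ∈? Y
      ... | yes u∈Y = pinch (proj₁ b₂) , pinch ∘ proj₂ b₂ ∘ (λ r∈Y → ∈∖⁺ r∈Y r∉D)
        where
        Y₁ = Y ∩ (D ∪ ⁅ u ⁆)
        Y₂ = Y ∖ D
        Y₁⊆H₁ : Y₁ ⊆ H C₁
        Y₁⊆H₁ x∈ with ∈∩⁻ x∈
        ... | x∈Y , x∈D∪u with ∈∪⁅⁆⁻ x∈D∪u
        ... | inj₁ x∈D  = to₁ (Y⊆ x∈Y) x∈D
        ... | inj₂ refl = grow-root (tree C₁)
        Y₂⊆H₂ : Y₂ ⊆ H C₂
        Y₂⊆H₂ x∈ = let x∈Y , x∉D = ∈∖⁻ x∈ in to₂ (Y⊆ x∈Y) x∉D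
        via-Y : Via u D Y
        via-Y a∈Y a∈D b∈Y = via-u (inA (Y⊆ a∈Y)) a∈D (inA (Y⊆ b∈Y))
        b₁ : Bound k₁ u Y₁
        b₁ = small C₁ Y₁ Y₁⊆H₁ (conn-inner conn via-Y) (mono-cong (sym ∘ col₁ ∘ Y₁⊆H₁) λ x∈ y∈ →
          mono (proj₁ (∈∩⁻ x∈)) (proj₁ (∈∩⁻ y∈)))
        b₂ : Bound k₂ r Y₂
        b₂ = small C₂ Y₂ Y₂⊆H₂ (conn-outer conn via-Y) (mono-cong (sym ∘ col₂ ∘ Y₂⊆H₂) λ x∈ y∈ →
          mono (proj₁ (∈∖⁻ x∈)) (proj₁ (∈∖⁻ y∈)))
        1+∣Y∣≤ : suc ∣ Y ∣ ≤ ∣ Y₁ ∣ + ∣ Y₂ ∣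
        1+∣Y∣≤ = begin
          suc ∣ Y ∣                    ≡⟨ cong suc (∣∩∣+∣∖∣ Y D) ⟨
          suc ∣ Y ∩ D ∣ + ∣ Y ∖ D ∣    ≤⟨ ℕ.+-monoˡ-≤ ∣ Y₂ ∣ (p⊂q⇒∣p∣<∣q∣ grows) ⟩
          ∣ Y₁ ∣ + ∣ Y₂ ∣              ∎
          where
          open ≤-Reasoning
          grows : Y ∩ D ⊂ Y₁
          grows = (λ x∈ → let x∈Y , x∈D = ∈∩⁻ x∈ in ∈∩⁺ x∈Y (∈∪ˡ x∈D)) ,
            u , ∈∩⁺ u∈Y (∈∪ʳ (x∈⁅x⁆ u)) , u∉D ∘ proj₂ ∘ ∈∩⁻
        -- Since `u` is the root of the far side, `Y₁` obeys the sharper bound `1 + k₁`. Counting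
        -- `u` twice gains 2 after doubling, which pays for this 1 and for the 1 in
        -- `k₁ + k₂ ≡ suc k`. The offset `i` is 2 in general and 1 when `r ∈ Y`, in which case `r`
        -- lies in `Y₂`.
        pinch : ∀ {i} → ∣ Y₂ ∣ + ∣ Y₂ ∣ ≤ i + k₂ → ∣ Y ∣ + ∣ Y ∣ ≤ i + k
        pinch {i} 2∣Y₂∣≤ = ℕ.+-cancelˡ-≤ 2 _ _ (begin
          2 + (∣ Y ∣ + ∣ Y ∣)                      ≡⟨ cong suc (ℕ.+-suc ∣ Y ∣ ∣ Y ∣) ⟨
          suc ∣ Y ∣ + suc ∣ Y ∣                    ≤⟨ ℕ.+-mono-≤ 1+∣Y∣≤ 1+∣Y∣≤ ⟩
          (∣ Y₁ ∣ + ∣ Y₂ ∣) + (∣ Y₁ ∣ + ∣ Y₂ ∣)    ≡⟨ +-interchange (∣ Y₁ ∣) (∣ Y₂ ∣) (∣ Y₁ ∣) (∣ Y₂ ∣) ⟩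
          (∣ Y₁ ∣ + ∣ Y₁ ∣) + (∣ Y₂ ∣ + ∣ Y₂ ∣)    ≤⟨ ℕ.+-mono-≤ (proj₂ b₁ (∈∩⁺ u∈Y (∈∪ʳ (x∈⁅x⁆ u)))) 2∣Y₂∣≤ ⟩
          (1 + k₁) + (i + k₂)                      ≡⟨ +-interchange 1 k₁ i k₂ ⟩
          (1 + i) + (k₁ + k₂)                      ≡⟨ cong (1 + i +_) k₁+k₂≡1+k ⟩
          (1 + i) + suc k                          ≡⟨ ℕ.+-suc (1 + i) k ⟩
          2 + (i + k)                              ∎)
          where
          open ≤-Reasoning
      ... | no u∉Y with any? (λ x → (x ∈? Y) ×-dec (x ∈? D))
      ... | no Y∩D≡∅ = ℕ.≤-trans (proj₁ b₂) (ℕ.+-monoʳ-≤ 2 k₂≤k) ,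
        λ r∈Y → ℕ.≤-trans (proj₂ b₂ r∈Y) (s≤s k₂≤k)
        where
        Y⊆H₂ : Y ⊆ H C₂
        Y⊆H₂ x∈Y = to₂ (Y⊆ x∈Y) λ x∈D → Y∩D≡∅ (_ , x∈Y , x∈D)
        b₂ = small C₂ Y Y⊆H₂ conn (mono-cong (sym ∘ col₂ ∘ Y⊆H₂) mono)
      -- Edges leaving `D` end at `u`, so the cluster is trapped in `D` and misses `r`.
      ... | yes (x , x∈Y , x∈D) = ℕ.≤-trans (proj₁ b₁) (ℕ.+-monoʳ-≤ 2 k₁≤k) ,
        λ r∈Y → contradiction (Y⊆D r∈Y) r∉D
        where
        Y⊆D : Y ⊆ D
        Y⊆D {y} y∈Y = decidable-stable (y ∈? D) λ y∉D →
          let a , b , (a∈Y , a∈D) , (b∈Y , b∉D) , a~b = conn D x∈Y x∈D y∈Y y∉D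
          in u∉Y (subst (_∈ Y) (via-u (inA (Y⊆ a∈Y)) a∈D (inA (Y⊆ b∈Y)) b∉D a~b) b∈Y)
        Y⊆H₁ : Y ⊆ H C₁
        Y⊆H₁ y∈Y = to₁ (Y⊆ y∈Y) (Y⊆D y∈Y)
        b₁ = small C₁ Y Y⊆H₁ conn (mono-cong (sym ∘ col₁ ∘ Y⊆H₁) mono)

  -- Adding one vertex, and the recursion for cells

  module _ (c : Fin n → Bool) (v : Fin n) (β : Bool) where

    recolour-mono : ∀ {Y x} → Mono (recolour c v β) Y → v ∈ Y → x ∈ Y → x ≢ v → c x ≡ β
    recolour-mono mono v∈Y x∈Y x≢v =
      trans (recolour-old c v β x≢v) (trans (mono x∈Y v∈Y) (recolour-new c v β))

  -- The clause at the root is the easier one to violate. Away from the root only the other clause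
  -- can fail, which gives one more in `¬bound⇒>`.
  ¬bound⇒≥ : ∀ {k r Y} → ¬ Bound k r Y → 2 + k ≤ ∣ Y ∣ + ∣ Y ∣
  ¬bound⇒≥ {k} {r} {Y} ¬b with 2 + k ℕ.≤? ∣ Y ∣ + ∣ Y ∣
  ... | yes p = p
  ... | no ¬p = contradiction (ℕ.m≤n⇒m≤1+n ≤1+k , const ≤1+k) ¬b
    where
    ≤1+k : ∣ Y ∣ + ∣ Y ∣ ≤ 1 + k
    ≤1+k = ℕ.≤-pred (ℕ.≰⇒> ¬p)

  ¬bound⇒> : ∀ {k r Y} → ¬ Bound k r Y → r ∉ Y → 3 + k ≤ ∣ Y ∣ + ∣ Y ∣
  ¬bound⇒> ¬b r∉Y = ℕ.≰⇒> λ p → ¬b (p , ⊥-elim ∘ r∉Y)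

  -- Y and Z total at most ∣ A ∣ + 1, and r lies in at most one of them.
  bound-one-of-two : ∀ {A Y Z : Subset n} {k r u} → ∣ A ∣ ≤ suc k → u ≢ r → Y ⊆ A → Z ⊆ A →
    (∀ {x} → x ∈ Y → x ∈ Z → x ≡ u) → ¬ Bound k r Y → ¬ ¬ Bound k r Z
  bound-one-of-two {A} {Y} {Z} {k} {r} {u} ∣A∣≤ u≢r Y⊆A Z⊆A meet ¬bY ¬bZ =
    ℕ.<⇒≱ 2∣Y∣+2∣Z∣<5+2k 5+2k≤
    where
    open ≤-Reasoning
    ∣Y∣+∣Z∣≤ : ∣ Y ∣ + ∣ Z ∣ ≤ 2 + k
    ∣Y∣+∣Z∣≤ = begin
      ∣ Y ∣ + ∣ Z ∣                    ≤⟨ ℕ.+-mono-≤ (p⊆q⇒∣p∣≤∣q∣ λ x∈Y → ∈∩⁺ (Y⊆A x∈Y) x∈Y) (p⊆q⇒∣p∣≤∣q∣ Z⊆) ⟩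
      ∣ A ∩ Y ∣ + ∣ A ∖ Y ∪ ⁅ u ⁆ ∣    ≤⟨ ℕ.+-monoʳ-≤ (∣ A ∩ Y ∣) (∣∪⁅⁆∣≤ (A ∖ Y) u) ⟩
      ∣ A ∩ Y ∣ + suc ∣ A ∖ Y ∣        ≡⟨ ℕ.+-suc (∣ A ∩ Y ∣) (∣ A ∖ Y ∣) ⟩
      suc (∣ A ∩ Y ∣ + ∣ A ∖ Y ∣)      ≡⟨ cong suc (∣∩∣+∣∖∣ A Y) ⟩
      suc ∣ A ∣                        ≤⟨ s≤s ∣A∣≤ ⟩
      2 + k                            ∎
      where
      Z⊆ : Z ⊆ A ∖ Y ∪ ⁅ u ⁆
      Z⊆ {x} x∈Z with x ∈? Y
      ... | no  x∉Y = ∈∪ˡ (∈∖⁺ (Z⊆A x∈Z) x∉Y)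
      ... | yes x∈Y with refl ← meet x∈Y x∈Z = ∈∪ʳ (x∈⁅x⁆ u)
    2∣Y∣+2∣Z∣<5+2k : (∣ Y ∣ + ∣ Y ∣) + (∣ Z ∣ + ∣ Z ∣) < 5 + (k + k)
    2∣Y∣+2∣Z∣<5+2k = s≤s (begin
      (∣ Y ∣ + ∣ Y ∣) + (∣ Z ∣ + ∣ Z ∣)  ≡⟨ +-interchange (∣ Y ∣) (∣ Y ∣) (∣ Z ∣) (∣ Z ∣) ⟩
      (∣ Y ∣ + ∣ Z ∣) + (∣ Y ∣ + ∣ Z ∣)  ≤⟨ ℕ.+-mono-≤ ∣Y∣+∣Z∣≤ ∣Y∣+∣Z∣≤ ⟩
      (2 + k) + (2 + k)                  ≡⟨ +-interchange 2 k 2 k ⟩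
      4 + (k + k)                        ∎)
    5+2k≤ : 5 + (k + k) ≤ (∣ Y ∣ + ∣ Y ∣) + (∣ Z ∣ + ∣ Z ∣)
    5+2k≤ with r ∈? Y
    ... | no r∉Y = begin
      5 + (k + k)          ≡⟨ +-interchange 3 2 k k ⟩
      (3 + k) + (2 + k)    ≤⟨ ℕ.+-mono-≤ (¬bound⇒> ¬bY r∉Y) (¬bound⇒≥ ¬bZ) ⟩
      (∣ Y ∣ + ∣ Y ∣) + (∣ Z ∣ + ∣ Z ∣)  ∎
    ... | yes r∈Y = begin
      5 + (k + k)          ≡⟨ +-interchange 2 3 k k ⟩
      (2 + k) + (3 + k)    ≤⟨ ℕ.+-mono-≤ (¬bound⇒≥ ¬bY) (¬bound⇒> ¬bZ λ r∈Z → u≢r (sym (meet r∈Y r∈Z))) ⟩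
      (∣ Y ∣ + ∣ Y ∣) + (∣ Z ∣ + ∣ Z ∣)  ∎

  -- The smaller cell already covers `A ∖ ⁅ u ⁆`. Give `u` the colour opposite to a neighbour `p`.
  -- If this creates too large a cluster `Y`, then `Y` contains a neighbour `q` of `u` with that
  -- colour, so `u` can hang from `q` with the colour of `p` instead. A cluster that is too large
  -- for this choice too would meet `Y` only in `u`, and `A` has no room for both.
  add-vertex : ∀ {A W r β k u} → 1 ≤ k → ∣ A ∣ ≤ suc k → Conn A → r ∈ A → u ∈ A → u ≢ r →
    (∀ {x} → x ∈ A → x ≢ r → x ∈ W) → Cell (A ∖ ⁅ u ⁆) W r β k → Cell A W r β k
  add-vertex {A} {W} {r} {β} {k} {u} 1≤k ∣A∣≤ conn r∈A u∈A u≢r A⊆W∪r C = result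
    where
    open Cell C

    u∉H : u ∉ H
    u∉H u∈H = proj₂ (∈∖⁅⁆⁻ (H⊆A u∈H)) refl

    A⊆H : ∀ {x} → x ∈ A → x ≢ u → x ∈ H
    A⊆H {x} x∈A x≢u with x ≟ r
    ... | yes refl = grow-root tree
    ... | no  x≢r  = W∩A⊆H (A⊆W∪r x∈A x≢r) (∈∖⁅⁆⁺ x∈A x≢u)

    H∪u⊆A : H ∪ ⁅ u ⁆ ⊆ A
    H∪u⊆A x∈ with ∈∪⁅⁆⁻ x∈
    ... | inj₁ x∈H  = proj₁ (∈∖⁅⁆⁻ (H⊆A x∈H))
    ... | inj₂ refl = u∈A

    Cluster : Bool → Subset n → Set
    Cluster γ Y = Y ⊆ H ∪ ⁅ u ⁆ × u ∈ Y × Conn Y × Mono (recolour c u γ) Y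

    coloured : ∀ γ {p} → p ∈ H → p ~ u → c p ≢ γ → (∀ Y → Cluster γ Y → Bound k r Y) → Cell A W r β k
    coloured γ p∈H p~u p≢γ new = record
      { H     = H ∪ ⁅ u ⁆
      ; c     = recolour c u γ
      ; tree  = attach c u γ u∉H tree p∈H p~u p≢γ
      ; cr≡β  = trans (sym (recolour-old c u γ (u≢r ∘ sym))) cr≡β
      ; H⊆A   = H∪u⊆A
      ; W∩A⊆H = λ {x} _ x∈A → W∩A⊆ x x∈A
      ; small = attach-small c u γ u∉H small λ Y Y⊆ u∈Y conn mono → new Y (Y⊆ , u∈Y , conn , mono)
      }
      where
      W∩A⊆ : ∀ x → x ∈ A → x ∈ H ∪ ⁅ u ⁆
      W∩A⊆ x x∈A with x ≟ u
      ... | yes refl = ∈∪ʳ (x∈⁅x⁆ u)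
      ... | no  x≢u  = ∈∪ˡ (A⊆H x∈A x≢u)

    violated? : ∀ γ → Dec (∃ λ Y → Cluster γ Y × ¬ Bound k r Y)
    violated? γ = anySubset? λ Y →
      ((Y ⊆? H ∪ ⁅ u ⁆) ×-dec (u ∈? Y) ×-dec (conn? Y) ×-dec (mono? (recolour c u γ) Y)) ×-dec ¬? (bound? k r Y)

    neighbour : ∃ λ p → p ∈ H × p ~ u
    neighbour with conn ⁅ u ⁆ u∈A (x∈⁅x⁆ u) r∈A (x≢y⇒x∉⁅y⁆ (u≢r ∘ sym))
    ... | a , b , (_ , a∈u) , (b∈A , b∉u) , a~b =
      b , A⊆H b∈A (x∉⁅y⁆⇒x≢y b∉u) , ~-sym (subst (_~ b) (x∈⁅y⁆⇒x≡y u a∈u) a~b)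

    result : Cell A W r β k
    result with neighbour
    ... | p , p∈H , p~u with violated? (not (c p))
    ... | no ¬violated = coloured (not (c p)) p∈H p~u (not-¬ refl) λ Y cl →
      decidable-stable (bound? k r Y) λ ¬b → ¬violated (Y , cl , ¬b)
    ... | yes (Y , (Y⊆ , u∈Y , connY , monoY) , ¬bY)
      with any? (λ q → (q ∈? H) ×-dec (u ~? q) ×-dec (c q ≟ᵇ not (c p)))
    -- Without a neighbour of the tried colour, `Y` is just `⁅ u ⁆`, which is within the bound.
    ... | no ¬q = contradiction (subst (Bound k r) (sym Y≡⁅u⁆) (bound-⁅⁆ 1≤k)) ¬bY
      where
      Y≡⁅u⁆ : Y ≡ ⁅ u ⁆
      Y≡⁅u⁆ = isolated c u (not (c p)) u∉H (λ q∈H u~q q≡ → ¬q (_ , q∈H , u~q , q≡)) Y Y⊆ u∈Y connY monoY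
    ... | yes (q , q∈H , u~q , q≡) = coloured (c p) q∈H (~-sym u~q) (λ q≡p → not-¬ q≡p q≡)
      λ Z (Z⊆ , u∈Z , connZ , monoZ) → decidable-stable (bound? k r Z)
        (bound-one-of-two ∣A∣≤ u≢r (H∪u⊆A ∘ Y⊆) (H∪u⊆A ∘ Z⊆)
          (λ {x} x∈Y x∈Z → decidable-stable (x ≟ u) λ x≢u →
            not-¬ (recolour-mono c u (c p) monoZ u∈Z x∈Z x≢u)
                  (recolour-mono c u (not (c p)) monoY u∈Y x∈Y x≢u))
          ¬bY)

  -- Without a cut vertex other than `r`, deleting any vertex but `r` keeps `A` connected. A
  -- nonterminal is deleted for good; once only terminals accompany `r`, one is deleted and later
  -- put back by `add-vertex`.
  cell : ∀ A → Acc _<_ ∣ A ∣ → ∀ W r β k → r ∈ A → Conn A → ∣ W ∣ ≤ k → 1 ≤ k → Cell A W r β k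
  cell A (acc rec) W r β k r∈A conn ∣W∣≤k 1≤k
    with any? (λ u → (u ∈? A) ×-dec ¬? (u ≟ r) ×-dec split? (A ∖ ⁅ u ⁆))
  ... | yes (u , u∈A , u≢r , split) with split⇒cut {r = r} split
  ... | D , cut with nonempty? (W ∩ D)
  -- No terminal lies beyond the cut, so the far side can be discarded.
  ... | no W∩D≡∅ = record
      { H = H ; c = c ; tree = tree ; cr≡β = cr≡β ; small = small
      ; H⊆A   = proj₁ ∘ ∈∖⁻ ∘ H⊆A
      ; W∩A⊆H = λ x∈W x∈A → W∩A⊆H x∈W (∈∖⁺ x∈A λ x∈D → W∩D≡∅ (_ , ∈∩⁺ x∈W x∈D))
      }
    where
    open Cut cut
    A∖D⊂A : ∣ A ∖ D ∣ < ∣ A ∣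
    A∖D⊂A = let x , x∈A , x∈D = inner in ∣∖∣< x∈A x∈D
    open Cell (cell (A ∖ D) (rec A∖D⊂A) W r β k (∈∖⁺ r∈A r∉D) (conn-outer conn via-u) ∣W∣≤k 1≤k)
  ... | yes (w , w∈) = glue cut k₁+k₂≡1+k 1≤k₁ k₁≤k u∈A C₂
      (cell (A ∩ (D ∪ ⁅ u ⁆)) (rec A₁⊂A) (W ∩ D) u (Cell.c C₂ u) k₁ (∈∩⁺ u∈A (∈∪ʳ (x∈⁅x⁆ u)))
        (conn-inner conn via-u) ℕ.≤-refl 1≤k₁)
    where
    open Cut cut
    k₁ = ∣ W ∩ D ∣
    A∖D⊂A : ∣ A ∖ D ∣ < ∣ A ∣
    A∖D⊂A = let x , x∈A , x∈D = inner in ∣∖∣< x∈A x∈D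
    A₁⊂A : ∣ A ∩ (D ∪ ⁅ u ⁆) ∣ < ∣ A ∣
    A₁⊂A = p⊂q⇒∣p∣<∣q∣ (proj₁ ∘ ∈∩⁻ , r , r∈A , λ r∈ → [ r∉D , u≢r ∘ sym ]′ (∈∪⁅⁆⁻ (proj₂ (∈∩⁻ r∈))))
    1≤k₁ : 1 ≤ k₁
    1≤k₁ = ℕ.≤-trans (ℕ.≤-reflexive (sym (∣⁅x⁆∣≡1 w)))
      (p⊆q⇒∣p∣≤∣q∣ λ x∈w → subst (_∈ W ∩ D) (sym (x∈⁅y⁆⇒x≡y w x∈w)) w∈)
    k₁+∣W∖D∣≤k : k₁ + ∣ W ∖ D ∣ ≤ k
    k₁+∣W∖D∣≤k = ℕ.≤-trans (ℕ.≤-reflexive (∣∩∣+∣∖∣ W D)) ∣W∣≤k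
    k₁≤k : k₁ ≤ k
    k₁≤k = ℕ.m+n≤o⇒m≤o k₁ k₁+∣W∖D∣≤k
    -- The far side is charged for its own terminals; the root side gets the remainder of `k` and
    -- one more for `u`.
    k₁+k₂≡1+k : k₁ + suc (k ∸ k₁) ≡ suc k
    k₁+k₂≡1+k = trans (ℕ.+-suc k₁ _) (cong suc (ℕ.m+[n∸m]≡n k₁≤k))
    ∣W₂∣≤ : ∣ W ∖ D ∪ ⁅ u ⁆ ∣ ≤ suc (k ∸ k₁)
    ∣W₂∣≤ = ℕ.≤-trans (∣∪⁅⁆∣≤ (W ∖ D) u)
      (s≤s (ℕ.m+n≤o⇒m≤o∸n _ (ℕ.≤-trans (ℕ.≤-reflexive (ℕ.+-comm _ k₁)) k₁+∣W∖D∣≤k)))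
    C₂ : Cell (A ∖ D) (W ∖ D ∪ ⁅ u ⁆) r β (suc (k ∸ k₁))
    C₂ = cell (A ∖ D) (rec A∖D⊂A) _ r β _ (∈∖⁺ r∈A r∉D) (conn-outer conn via-u) ∣W₂∣≤ (s≤s z≤n)
  cell A (acc rec) W r β k r∈A conn ∣W∣≤k 1≤k
      | no uncut with any? (λ u → (u ∈? A) ×-dec ¬? (u ≟ r))
  ... | no A⊆r = singleton-cell 1≤k r∈A λ {x} x∈A → decidable-stable (x ≟ r) λ x≢r → A⊆r (x , x∈A , x≢r)
  ... | yes (u₀ , u₀∈A , u₀≢r) with any? (λ u → (u ∈? A) ×-dec ¬? (u ≟ r) ×-dec ¬? (u ∈? W))
  ... | yes (u , u∈A , u≢r , u∉W) = record
      { H = H ; c = c ; tree = tree ; cr≡β = cr≡β ; small = small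
      ; H⊆A   = proj₁ ∘ ∈∖⁅⁆⁻ ∘ H⊆A
      ; W∩A⊆H = λ x∈W x∈A → W∩A⊆H x∈W (∈∖⁅⁆⁺ x∈A λ { refl → u∉W x∈W })
      }
    where
    open Cell (cell (A ∖ ⁅ u ⁆) (rec (∣∖∣< u∈A (x∈⁅x⁆ u)))
      W r β k (∈∖⁅⁆⁺ r∈A (u≢r ∘ sym)) (¬split⇒conn λ split → uncut (u , u∈A , u≢r , split)) ∣W∣≤k 1≤k)
  ... | no A⊆W∪r = add-vertex 1≤k ∣A∣≤ conn r∈A u₀∈A u₀≢r A⊆
      (cell (A ∖ ⁅ u₀ ⁆) (rec (∣∖∣< u₀∈A (x∈⁅x⁆ u₀)))
        W r β k (∈∖⁅⁆⁺ r∈A (u₀≢r ∘ sym)) (¬split⇒conn λ split → uncut (u₀ , u₀∈A , u₀≢r , split)) ∣W∣≤k 1≤k)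
    where
    A⊆ : ∀ {x} → x ∈ A → x ≢ r → x ∈ W
    A⊆ {x} x∈A x≢r = decidable-stable (x ∈? W) λ x∉W → A⊆W∪r (x , x∈A , x≢r , x∉W)
    A⊆′ : A ⊆ W ∪ ⁅ r ⁆
    A⊆′ {x} x∈A with x ≟ r
    ... | yes refl = ∈∪ʳ (x∈⁅x⁆ r)
    ... | no  x≢r  = ∈∪ˡ (A⊆ x∈A x≢r)
    ∣A∣≤ : ∣ A ∣ ≤ suc k
    ∣A∣≤ = ℕ.≤-trans (p⊆q⇒∣p∣≤∣q∣ A⊆′) (ℕ.≤-trans (∣∪⁅⁆∣≤ W r) (s≤s ∣W∣≤k))

  abstract
    spanning-cell : ∀ {A} W {r} β k → r ∈ A → Conn A → ∣ W ∣ ≤ k → 1 ≤ k → Cell A W r β k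
    spanning-cell W β k r∈A = cell _ (<-wellFounded _) W _ β k r∈A

  -- Saturating a coloured tree

  Sees : (Fin n → Bool) → Subset n → Fin n → Bool → Set
  Sees c H v β = ∃ λ y → y ∈ H × v ~ y × c y ≡ β

  blind? : ∀ c H v → Dec (∃ λ β → ¬ Sees c H v β)
  blind? c H v with sees? true | sees? false
    where
    sees? : ∀ β → Dec (Sees c H v β)
    sees? β = any? λ y → (y ∈? H) ×-dec (v ~? y) ×-dec (c y ≟ᵇ β)
  ... | no ¬sees  | _         = yes (true , ¬sees)
  ... | yes _     | no ¬sees  = yes (false , ¬sees)
  ... | yes seesT | yes seesF = no λ { (true , ¬sees) → ¬sees seesT ; (false , ¬sees) → ¬sees seesF }

  -- This makes later links possible: whatever colour an adjacent vertex of `X` receives, some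
  -- neighbour of it in `H` has the same one.
  Full : Subset n → (Fin n → Bool) → Subset n → Set
  Full X c H = ∀ {v} → v ∈ X → (∃ λ y → y ∈ H × v ~ y) → ∀ β → Sees c H v β

  record Saturated (X : Subset n) (B : Subset n → Set) (r : Fin n) (H₀ : Subset n) : Set where
    field
      H     : Subset n
      c     : Fin n → Bool
      tree  : Grow c r H
      H₀⊆H  : H₀ ⊆ H
      H⊆X   : H ⊆ X
      small : Small B c H
      full  : Full (X ∖ H) c H

  abstract
    -- Suppose `v` has a neighbour in `H` but sees no vertex of colour `β` there. Coloured `β`, it
    -- can hang from that neighbour and forms a cluster by itself, so no old cluster grows.
    saturate : ∀ {X B c r H} → (∀ v → B ⁅ v ⁆) → Grow c r H → H ⊆ X → Small B c H →
      Acc _<_ ∣ X ∖ H ∣ → Saturated X B r H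
    saturate {X} {B} {c} {r} {H} B⁅⁆ tree H⊆X small (acc rec)
      with any? (λ v → ((v ∈? X) ×-dec ¬? (v ∈? H)) ×-dec
                       any? (λ y → (y ∈? H) ×-dec (v ~? y)) ×-dec blind? c H v)
    ... | no saturated = record
        { H = H ; c = c ; tree = tree ; H₀⊆H = id ; H⊆X = H⊆X ; small = small ; full = full }
      where
      full : Full (X ∖ H) c H
      full {v} v∈ nbr β = decidable-stable (any? λ y → (y ∈? H) ×-dec (v ~? y) ×-dec (c y ≟ᵇ β))
        λ ¬sees → saturated (v , ∈∖⁻ v∈ , nbr , β , ¬sees)
    ... | yes (v , (v∈X , v∉H) , (y , y∈H , v~y) , β , ¬sees) = record
        { H = H′.H ; c = H′.c ; tree = H′.tree ; H₀⊆H = H′.H₀⊆H ∘ ∈∪ˡ ; H⊆X = H′.H⊆X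
      ; small = H′.small ; full = H′.full }
      where
      other : ∀ {y} → y ∈ H → v ~ y → c y ≢ β
      other y∈H v~y cy≡β = ¬sees (_ , y∈H , v~y , cy≡β)
      H∪v⊆X : H ∪ ⁅ v ⁆ ⊆ X
      H∪v⊆X x∈ with ∈∪⁅⁆⁻ x∈
      ... | inj₁ x∈H  = H⊆X x∈H
      ... | inj₂ refl = v∈X
      fewer : ∣ X ∖ (H ∪ ⁅ v ⁆) ∣ < ∣ X ∖ H ∣
      fewer = p⊂q⇒∣p∣<∣q∣
        ( (λ x∈ → let x∈X , x∉ = ∈∖⁻ x∈ in ∈∖⁺ x∈X (x∉ ∘ ∈∪ˡ))
        , v , ∈∖⁺ v∈X v∉H , λ v∈ → proj₂ (∈∖⁻ v∈) (∈∪ʳ (x∈⁅x⁆ v)) )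
      module H′ = Saturated (saturate {X} {B} B⁅⁆
        (attach c v β v∉H tree y∈H (~-sym v~y) (other y∈H v~y)) H∪v⊆X
        (attach-small c v β v∉H small λ Y Y⊆ v∈Y conn mono →
          subst B (sym (isolated c v β v∉H other Y Y⊆ v∈Y conn mono)) (B⁅⁆ v))
        (rec fewer))

  -- Pieces and the links between them

  record Piece (h : ℕ) : Set where
    field
      S    : Subset n
      c    : Fin n → Bool
      r    : Fin n
      tree : Grow c r S
      S⊆V  : S ⊆ V G
      hue  : Fin h

  open Piece

  -- Each end is judged by its own piece's colouring: combined, these colourings give the
  -- 2-colouring of the odd expansion.
  OddLink : ∀ {h} → Piece h → Piece h → Set
  OddLink P Q = (∀ {x} → x ∈ S P → x ∉ S Q) ×
    ∃₂ λ x y → x ∈ S P × y ∈ S Q × x ~ y × c P x ≡ c Q y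

  Adj : ∀ {h} → Subset n → Piece h → Set
  Adj X P = ∃₂ λ x y → x ∈ X × y ∈ S P × x ~ y

  adj? : ∀ {h} X (P : Piece h) → Dec (Adj X P)
  adj? X P = any? λ x → any? λ y → (x ∈? X) ×-dec (y ∈? S P) ×-dec (x ~? y)

  terminals : ∀ {h X} (Ps : List (Piece h)) → All (Adj X) Ps →
    ∃ λ W → ∣ W ∣ ≤ length Ps × All (λ P → ∃ λ x → x ∈ W × x ∈ X × ∃ λ y → y ∈ S P × x ~ y) Ps
  terminals [] [] = ⊥ˢ , ℕ.≤-reflexive (∣⊥∣≡0 n) , []
  terminals (P ∷ Ps) ((x , y , x∈X , y∈P , x~y) ∷ adj) with terminals Ps adj
  ... | W , ∣W∣≤ , met =
    W ∪ ⁅ x ⁆ , ℕ.≤-trans (∣∪⁅⁆∣≤ W x) (s≤s ∣W∣≤) ,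
    (x , ∈∪ʳ (x∈⁅x⁆ x) , x∈X , y , y∈P , x~y) ∷ All.map (λ (x , x∈W , rest) → x , ∈∪ˡ x∈W , rest) met

  -- The vertex chosen for the first piece serves as the root, which saves one terminal. With no
  -- pieces any vertex of `X` will do.
  rooted-terminals : ∀ {h X} → ∃ (_∈ X) → (Ps : List (Piece h)) → All (Adj X) Ps →
    ∃₂ λ r W → r ∈ X × ∣ W ∣ ≤ length Ps ∸ 1 ×
      All (λ P → ∃ λ x → (x ≡ r ⊎ x ∈ W) × x ∈ X × ∃ λ y → y ∈ S P × x ~ y) Ps
  rooted-terminals (x , x∈X) [] [] = x , ⊥ˢ , x∈X , ℕ.≤-reflexive (∣⊥∣≡0 n) , []
  rooted-terminals _ (P ∷ Ps) ((x , y , x∈X , y∈P , x~y) ∷ adj) with terminals Ps adj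
  ... | W , ∣W∣≤ , met = x , W , x∈X , ∣W∣≤ ,
    (x , inj₁ refl , x∈X , y , y∈P , x~y) ∷ All.map (λ (x , x∈W , rest) → x , inj₂ x∈W , rest) met

  -- Colouring piece by piece

  module _ {j : ℕ} (limit : (Ps : List (Piece (2 + j))) → AllPairs OddLink Ps → length Ps ≤ 2 + j) where

    h : ℕ
    h = 2 + j

    -- With `t = 3 + j`, a new piece is linked to at most `1 + j` earlier ones, which leaves `j`
    -- terminals besides the root. The maximum with 1 reflects that cells need a positive `k`.
    ClusterBound : Subset n → Set
    ClusterBound Y = ∣ Y ∣ + ∣ Y ∣ ≤ 2 + (1 ⊔ j)

    -- The field `avoids` is what stops clusters from running between `X` and the earlier pieces.
    record Colouring (X : Subset n) (Ps : List (Piece h)) : Set where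
      field
        f      : Fin n → Fin h × Bool
        avoids : ∀ {P} → P ∈ₗ Ps → ∀ {x y} → x ∈ X → y ∈ S P → x ~ y → proj₁ (f x) ≢ hue P
        small  : Small ClusterBound f X

    open Colouring

    -- No edge between the two sides is monochromatic, so every cluster lies on one side.
    join : ∀ {X D Ps} (F : Colouring (X ∩ D) Ps) (F′ : Colouring (X ∖ D) Ps) →
      (∀ {a b} → a ∈ X → a ∈ D → b ∈ X → b ∉ D → a ~ b → f F a ≢ f F′ b) → Colouring X Ps
    join {X} {D} {Ps} F F′ differ = record { f = g ; avoids = avoids′ ; small = small′ }
      where
      g : Fin n → Fin h × Bool
      g x with x ∈? D
      ... | yes _ = f F x
      ... | no  _ = f F′ x

      g-in : ∀ {x} → x ∈ D → g x ≡ f F x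
      g-in {x} x∈D with x ∈? D
      ... | yes _   = refl
      ... | no  x∉D = contradiction x∈D x∉D

      g-out : ∀ {x} → x ∉ D → g x ≡ f F′ x
      g-out {x} x∉D with x ∈? D
      ... | yes x∈D = contradiction x∈D x∉D
      ... | no  _   = refl

      avoids′ : ∀ {P} → P ∈ₗ Ps → ∀ {x y} → x ∈ X → y ∈ S P → x ~ y → proj₁ (g x) ≢ hue P
      avoids′ P∈ {x} x∈X y∈P x~y with x ∈? D
      ... | yes x∈D = avoids F P∈ (∈∩⁺ x∈X x∈D) y∈P x~y
      ... | no  x∉D = avoids F′ P∈ (∈∖⁺ x∈X x∉D) y∈P x~y

      small′ : Small ClusterBound g X
      small′ Y Y⊆X conn mono with any? (λ x → (x ∈? Y) ×-dec (x ∈? D))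
      ... | no Y∩D≡∅ = small F′ Y (λ x∈Y → ∈∖⁺ (Y⊆X x∈Y) (Y∉D x∈Y)) conn (mono-cong (g-out ∘ Y∉D) mono)
        where
        Y∉D : ∀ {x} → x ∈ Y → x ∉ D
        Y∉D x∈Y x∈D = Y∩D≡∅ (_ , x∈Y , x∈D)
      ... | yes (x , x∈Y , x∈D) =
        small F Y (λ x∈Y → ∈∩⁺ (Y⊆X x∈Y) (Y⊆D x∈Y)) conn (mono-cong (g-in ∘ Y⊆D) mono)
        where
        Y⊆D : Y ⊆ D
        Y⊆D {y} y∈Y = decidable-stable (y ∈? D) λ y∉D →
          let a , b , (a∈Y , a∈D) , (b∈Y , b∉D) , a~b = conn D x∈Y x∈D y∈Y y∉D
          in differ (Y⊆X a∈Y) a∈D (Y⊆X b∈Y) b∉D a~b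
               (trans (sym (g-in a∈D)) (trans (mono a∈Y b∈Y) (g-out b∉D)))

    record NewPiece (X : Subset n) (Ps : List (Piece h)) : Set where
      field
        new      : Piece h
        linked   : All (OddLink new) Ps
        hue-new  : ∀ {P} → P ∈ₗ Ps → hue new ≢ hue P
        root∈X   : r new ∈ X
        full     : Full (X ∖ S new) (c new) (S new)
        small    : Small ClusterBound (c new) (S new)

    new-piece : ∀ {X} → X ⊆ V G → ∃ (_∈ X) → Conn X → ∀ Ps → AllPairs OddLink Ps → All (Adj X) Ps →
      (∀ {P} → P ∈ₗ Ps → Full X (c P) (S P)) → (∀ {P} → P ∈ₗ Ps → ∀ {x} → x ∈ X → x ∉ S P) →
      NewPiece X Ps
    new-piece {X} X⊆V X≢∅ conn Ps linked adj full disjoint with rooted-terminals X≢∅ Ps adj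
    ... | r , W , r∈X , ∣W∣≤ , met = build
      -- The colour of the root is arbitrary here.
      (spanning-cell W true k r∈X conn (ℕ.≤-trans ∣W∣≤ (ℕ.m≤n⊔m 1 (length Ps ∸ 1))) 1≤k)
      where
      k : ℕ
      k = 1 ⊔ (length Ps ∸ 1)

      1≤k : 1 ≤ k
      1≤k = ℕ.m≤m⊔n 1 (length Ps ∸ 1)

      build : Cell X W r true k → NewPiece X Ps
      build C = coloured (saturate {X} {λ Y → ∣ Y ∣ + ∣ Y ∣ ≤ 2 + k}
        (λ v → proj₁ (bound-⁅⁆ {r = r} {v} 1≤k)) C.tree C.H⊆A
        (λ Y Y⊆H conn mono → proj₁ (C.small Y Y⊆H conn mono)) (<-wellFounded _))
        where
        module C = Cell C

        coloured : Saturated X (λ Y → ∣ Y ∣ + ∣ Y ∣ ≤ 2 + k) r C.H → NewPiece X Ps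
        coloured N = record
          { new     = piece γ
          ; linked  = All.tabulate (link γ)
          ; hue-new = λ P∈ γ≡ → proj₂ fresh-hue (subst (_∈ₗ map hue Ps) (sym γ≡) (∈-map⁺ hue P∈))
          ; root∈X  = r∈X
          ; full    = N.full
          ; small   = λ Y Y⊆ conn mono → ℕ.≤-trans (N.small Y Y⊆ conn mono) (ℕ.+-monoʳ-≤ 2 k≤)
          }
          where
          module N = Saturated N

          piece : Fin h → Piece h
          piece γ = record { S = N.H ; c = N.c ; r = r ; tree = N.tree ; S⊆V = X⊆V ∘ N.H⊆X ; hue = γ }

          link : ∀ γ {P} → P ∈ₗ Ps → OddLink (piece γ) P
          link γ P∈ with All.lookup met P∈
          -- Fullness is invoked for whichever colour `x` received in the new piece.
          ... | x , x∈r⊎W , x∈X , y , y∈P , x~y with full P∈ x∈X (y , y∈P , x~y) (N.c x)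
          ... | z , z∈P , x~z , cz≡cx =
            (λ x∈H → disjoint P∈ (N.H⊆X x∈H)) , x , z , N.H₀⊆H (x∈C x∈r⊎W) , z∈P , x~z , sym cz≡cx
            where
            x∈C : x ≡ r ⊎ x ∈ W → x ∈ C.H
            x∈C (inj₁ refl) = grow-root C.tree
            x∈C (inj₂ x∈W)  = C.W∩A⊆H x∈W x∈X

          ∣Ps∣≤1+j : length Ps ≤ 1 + j
          -- Links do not depend on hues, so an arbitrary hue serves for the count that then shows a
          -- free hue to exist.
          ∣Ps∣≤1+j = ℕ.≤-pred (limit (piece Fin.zero ∷ Ps) (All.tabulate (link Fin.zero) ∷ linked))

          k≤ : k ≤ 1 ⊔ j
          k≤ = ℕ.⊔-mono-≤ {1} ℕ.≤-refl (ℕ.∸-monoˡ-≤ 1 ∣Ps∣≤1+j)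

          fresh-hue : ∃ (_∉ₗ map hue Ps)
          fresh-hue = fresh (map hue Ps) (ℕ.≤-trans (s≤s (ℕ.≤-reflexive (length-map hue Ps))) (s≤s ∣Ps∣≤1+j))

          γ : Fin h
          γ = proj₁ fresh-hue

    -- A disconnected `X` is coloured part by part. From a connected one a new piece is taken off,
    -- and the rest is coloured with that piece added to the list; fullness and disjointness pass to
    -- subsets of `X`.
    colouring : ∀ X → Acc _<_ ∣ X ∣ → X ⊆ V G → ∀ Ps → AllPairs OddLink Ps →
      (∀ {P} → P ∈ₗ Ps → Full X (c P) (S P)) → (∀ {P} → P ∈ₗ Ps → ∀ {x} → x ∈ X → x ∉ S P) →
      Colouring X Ps
    colouring X (acc rec) X⊆V Ps linked full disjoint with nonempty? X | split? X
    ... | no X≡∅ | _ = record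
      { f      = const (Fin.zero , true)
      ; avoids = λ _ x∈X → contradiction (_ , x∈X) X≡∅
      ; small  = λ Y Y⊆X _ _ → let Y≡∅ = Empty-unique λ (_ , x∈Y) → X≡∅ (_ , Y⊆X x∈Y) in
          subst ClusterBound (sym Y≡∅) (ℕ.≤-trans (ℕ.≤-reflexive (cong₂ _+_ (∣⊥∣≡0 n) (∣⊥∣≡0 n))) z≤n)
      }
    ... | yes _ | yes (D , (x , x∈X , x∈D) , (y , y∈X , y∉D) , ¬crossed) =
      join {D = D}
        (colouring (X ∩ D) (rec X∩D⊂X) (X⊆V ∘ proj₁ ∘ ∈∩⁻) Ps linked
          (λ P∈ → full P∈ ∘ proj₁ ∘ ∈∩⁻) (λ P∈ → disjoint P∈ ∘ proj₁ ∘ ∈∩⁻))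
        (colouring (X ∖ D) (rec (∣∖∣< x∈X x∈D)) (X⊆V ∘ proj₁ ∘ ∈∖⁻) Ps linked
          (λ P∈ → full P∈ ∘ proj₁ ∘ ∈∖⁻) (λ P∈ → disjoint P∈ ∘ proj₁ ∘ ∈∖⁻))
        λ a∈X a∈D b∈X b∉D a~b → contradiction (_ , _ , (a∈X , a∈D) , (b∈X , b∉D) , a~b) ¬crossed
      where
      X∩D⊂X : ∣ X ∩ D ∣ < ∣ X ∣
      X∩D⊂X = p⊂q⇒∣p∣<∣q∣ (proj₁ ∘ ∈∩⁻ , y , y∈X , y∉D ∘ proj₂ ∘ ∈∩⁻)
    ... | yes X≢∅ | no ¬split = join {D = S new} inner outer differ
      where
      -- Pieces without an edge to `X` impose nothing on its colouring, and the new piece need not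
      -- be linked to them; they are dropped so that the list stays pairwise linked.
      Ps′ : List (Piece h)
      Ps′ = filter (adj? X) Ps

      ⊆Ps : ∀ {P} → P ∈ₗ Ps′ → P ∈ₗ Ps
      ⊆Ps = proj₁ ∘ ∈-filter⁻ (adj? X)

      ∈Ps′ : ∀ {P} → P ∈ₗ Ps → ∀ {x y} → x ∈ X → y ∈ S P → x ~ y → P ∈ₗ Ps′
      ∈Ps′ P∈ x∈X y∈P x~y = ∈-filter⁺ (adj? X) P∈ (_ , _ , x∈X , y∈P , x~y)

      linked′ : AllPairs OddLink Ps′
      linked′ = AllPairs.filter⁺ (adj? X) linked

      module N = NewPiece (new-piece X⊆V X≢∅ (¬split⇒conn ¬split) Ps′ linked′ (all-filter (adj? X) Ps)
        (full ∘ ⊆Ps) (disjoint ∘ ⊆Ps))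
      open N using (new)

      inner : Colouring (X ∩ S new) Ps
      inner = record
        { f      = λ x → hue new , c new x
        ; avoids = λ P∈ x∈ y∈P x~y → N.hue-new (∈Ps′ P∈ (proj₁ (∈∩⁻ x∈)) y∈P x~y)
        ; small  = λ Y Y⊆ conn mono → N.small Y (proj₂ ∘ ∈∩⁻ ∘ Y⊆) conn λ x∈Y y∈Y → cong proj₂ (mono x∈Y y∈Y)
        }

      rest : Colouring (X ∖ S new) (new ∷ Ps′)
      rest = colouring (X ∖ S new) (rec (∣∖∣< N.root∈X (grow-root (tree new)))) (X⊆V ∘ proj₁ ∘ ∈∖⁻)
        _ (N.linked ∷ linked′) full′ disjoint′
        where
        full′ : ∀ {P} → P ∈ₗ new ∷ Ps′ → Full (X ∖ S new) (c P) (S P)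
        full′ (here refl) = N.full
        full′ (there P∈)  = full (⊆Ps P∈) ∘ proj₁ ∘ ∈∖⁻
        disjoint′ : ∀ {P} → P ∈ₗ new ∷ Ps′ → ∀ {x} → x ∈ X ∖ S new → x ∉ S P
        disjoint′ (here refl) = proj₂ ∘ ∈∖⁻
        disjoint′ (there P∈)  = disjoint (⊆Ps P∈) ∘ proj₁ ∘ ∈∖⁻

      outer : Colouring (X ∖ S new) Ps
      outer = record
        { f      = f rest
        ; avoids = λ P∈ x∈ y∈P x~y → avoids rest (there (∈Ps′ P∈ (proj₁ (∈∖⁻ x∈)) y∈P x~y)) x∈ y∈P x~y
        ; small  = small rest
        }

      differ : ∀ {a b} → a ∈ X → a ∈ S new → b ∈ X → b ∉ S new → a ~ b → f inner a ≢ f outer b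
      differ a∈X a∈H b∈X b∉H a~b eq =
        avoids rest (here refl) (∈∖⁺ b∈X b∉H) a∈H (~-sym a~b) (sym (cong proj₁ eq))

  -- The grown trees as graphs

  Edge : ∀ {c r H} → Grow c r H → Fin n → Fin n → Set
  Edge root                         x y = ⊥
  Edge (leaf {p = p} {v} g _ _ _ _) x y = Edge g x y ⊎ (x ≡ p × y ≡ v) ⊎ (x ≡ v × y ≡ p)

  module _ {c : Fin n → Bool} {r : Fin n} where

    edge? : ∀ {H} (g : Grow c r H) x y → Dec (Edge g x y)
    edge? root                         x y = no id
    edge? (leaf {p = p} {v} g _ _ _ _) x y =
      edge? g x y ⊎-dec ((x ≟ p) ×-dec (y ≟ v)) ⊎-dec ((x ≟ v) ×-dec (y ≟ p))

    edge-sym : ∀ {H} (g : Grow c r H) {x y} → Edge g x y → Edge g y x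
    edge-sym (leaf g _ _ _ _) (inj₁ e)                   = inj₁ (edge-sym g e)
    edge-sym (leaf g _ _ _ _) (inj₂ (inj₁ (x≡p , y≡v))) = inj₂ (inj₂ (y≡v , x≡p))
    edge-sym (leaf g _ _ _ _) (inj₂ (inj₂ (x≡v , y≡p))) = inj₂ (inj₁ (y≡p , x≡v))

    edge⇒∈ : ∀ {H} (g : Grow c r H) {x y} → Edge g x y → x ∈ H
    edge⇒∈ (leaf g _   _ _ _) (inj₁ e)                   = ∈∪ˡ (edge⇒∈ g e)
    edge⇒∈ (leaf g p∈H _ _ _) (inj₂ (inj₁ (refl , _))) = ∈∪ˡ p∈H
    edge⇒∈ (leaf g _   _ _ _) (inj₂ (inj₂ (refl , _))) = ∈∪ʳ (x∈⁅x⁆ _)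

    edge⇒~ : ∀ {H} (g : Grow c r H) {x y} → Edge g x y → x ~ y
    edge⇒~ (leaf g _ _ _   _) (inj₁ e)                      = edge⇒~ g e
    edge⇒~ (leaf g _ _ p~v _) (inj₂ (inj₁ (refl , refl))) = p~v
    edge⇒~ (leaf g _ _ p~v _) (inj₂ (inj₂ (refl , refl))) = ~-sym p~v

    edge⇒≢ : ∀ {H} (g : Grow c r H) {x y} → Edge g x y → c x ≢ c y
    edge⇒≢ (leaf g _ _ _ _)   (inj₁ e)                      = edge⇒≢ g e
    edge⇒≢ (leaf g _ _ _ p≢v) (inj₂ (inj₁ (refl , refl))) = p≢v
    edge⇒≢ (leaf g _ _ _ p≢v) (inj₂ (inj₂ (refl , refl))) = p≢v ∘ sym

    edge-path : ∀ {H} (g : Grow c r H) {x} → x ∈ H → Star (Edge g) r x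
    edge-path root x∈ with refl ← x∈⁅y⁆⇒x≡y r x∈ = ε
    edge-path (leaf g p∈H _ _ _) x∈ with ∈∪⁅⁆⁻ x∈
    ... | inj₁ x∈H  = Star.map inj₁ (edge-path g x∈H)
    ... | inj₂ refl = Star.map inj₁ (edge-path g p∈H) ◅◅ (inj₂ (inj₁ (refl , refl)) ◅ ε)

    -- The last leaf has only its parent as neighbour, so it is not in `L`. All edges within `L`
    -- then belong to the smaller tree.
    ¬edge-two-neighbours : ∀ {H} (g : Grow c r H) {L x} → x ∈ₗ L → ¬ TwoNeighbours (Edge g) L
    ¬edge-two-neighbours root x∈L two with two x∈L
    ... | _ , _ , _ , _ , _ , () , _
    ¬edge-two-neighbours (leaf {H} {p} {v} g p∈H v∉H _ _) {L} x∈L two = ¬edge-two-neighbours g x∈L two′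
      where
      only-p : ∀ {y} → Edge g v y ⊎ (v ≡ p × y ≡ v) ⊎ (v ≡ v × y ≡ p) → y ≡ p
      only-p (inj₁ e)                   = contradiction (edge⇒∈ g e) v∉H
      only-p (inj₂ (inj₁ (v≡p , _))) = contradiction (subst (_∈ H) (sym v≡p) p∈H) v∉H
      only-p (inj₂ (inj₂ (_ , y≡p))) = y≡p

      v∉L : v ∉ₗ L
      v∉L v∈L with two v∈L
      ... | y , z , y≢z , _ , _ , vy , vz = y≢z (trans (only-p vy) (sym (only-p vz)))

      old : ∀ {x y} → x ∈ₗ L → y ∈ₗ L → Edge g x y ⊎ (x ≡ p × y ≡ v) ⊎ (x ≡ v × y ≡ p) → Edge g x y
      old _   _   (inj₁ e)                   = e
      old _   y∈L (inj₂ (inj₁ (_ , refl))) = contradiction y∈L v∉L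
      old x∈L _   (inj₂ (inj₂ (refl , _))) = contradiction x∈L v∉L

      two′ : TwoNeighbours (Edge g) L
      two′ x∈L with two x∈L
      ... | y , z , y≢z , y∈L , z∈L , xy , xz = y , z , y≢z , y∈L , z∈L , old x∈L y∈L xy , old x∈L z∈L xz

    tree-graph : ∀ {H} → Grow c r H → Graph n
    tree-graph {H} g = record
      { V        = H
      ; _~_      = Edge g
      ; _~?_     = edge? g
      ; ~-sym    = edge-sym g
      ; ~-irrefl = λ x≡y → ~-irrefl x≡y ∘ edge⇒~ g
      ; ~⇒∈V     = edge⇒∈ g
      }

    tree-graph-isTree : ∀ {H} (g : Grow c r H) → IsTree (tree-graph g)
    tree-graph-isTree g =
      ( (r , grow-root g)
      , λ u∈H v∈H → Star.reverse (edge-sym g) (edge-path g u∈H) ◅◅ edge-path g v∈H )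
      , λ v vs (3≤ , unique , linked) →
          ¬edge-two-neighbours g (here refl) (cycle-two-neighbours (edge-sym g) 3≤ unique linked)

  -- The odd expansion formed by pairwise linked pieces

  module _ {h t : ℕ} (P : Fin t → Piece h) (link : ∀ {i j} → i Fin.< j → OddLink (P i) (P j)) where

    -- Deciding `i < j` makes the chosen edge a function of the pair alone, independent of the proof
    -- of `i < j`; its uniqueness rests on this.
    joint : Fin t → Fin t → Fin n × Fin n
    joint i j with i <? j
    ... | yes i<j = let _ , x , y , _ = link i<j in x , y
    -- A filler: `joint i j` is consulted only when `i < j`.
    ... | no  _   = r (P i) , r (P i)

    Joint : Fin t → Fin t → Fin n × Fin n → Set
    Joint i j (x , y) = x ∈ S (P i) × y ∈ S (P j) × x ~ y × c (P i) x ≡ c (P j) y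

    joint-spec : ∀ {i j} → i Fin.< j → Joint i j (joint i j)
    joint-spec {i} {j} i<j with i <? j
    ... | yes i<j′ = let _ , _ , _ , spec = link i<j′ in spec
    ... | no  i≮j  = contradiction i<j i≮j

    same-piece : ∀ {i j x} → x ∈ S (P i) → x ∈ S (P j) → i ≡ j
    same-piece {i} {j} x∈i x∈j with <-cmp i j
    ... | tri< i<j _ _ = contradiction x∈j (proj₁ (link i<j) x∈i)
    ... | tri≈ _ i≡j _ = i≡j
    ... | tri> _ _ j<i = contradiction x∈i (proj₁ (link j<i) x∈j)

    Inner Joined : Fin n → Fin n → Set
    Inner u v  = ∃ λ i → Edge (tree (P i)) u v
    Joined u v = ∃₂ λ i j → i Fin.< j × joint i j ≡ (u , v)

    joined-spec : ∀ {u v} → Joined u v → ∃₂ λ i j → i Fin.< j × joint i j ≡ (u , v) × Joint i j (u , v)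
    joined-spec (i , j , i<j , eq) = i , j , i<j , eq , subst (Joint i j) eq (joint-spec i<j)

    covered? : ∀ v → Dec (∃ λ i → v ∈ S (P i))
    covered? v = any? λ i → v ∈? S (P i)

    vertices : Subset n
    vertices = tabulate (does ∘ covered?)

    ∈-vertices : ∀ {i v} → v ∈ S (P i) → v ∈ vertices
    ∈-vertices v∈ = ∈-tabulate⁺ covered? (_ , v∈)

    -- Other edges of `G` among the pieces are left out, as an expansion permits none.
    _~F_ : Fin n → Fin n → Set
    u ~F v = Inner u v ⊎ Joined u v ⊎ Joined v u

    ~F⇒~ : ∀ {u v} → u ~F v → u ~ v
    ~F⇒~ (inj₁ (i , e))  = edge⇒~ (tree (P i)) e
    ~F⇒~ (inj₂ (inj₁ e)) = let _ , _ , _ , _ , _ , _ , u~v , _ = joined-spec e in u~v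
    ~F⇒~ (inj₂ (inj₂ e)) = let _ , _ , _ , _ , _ , _ , v~u , _ = joined-spec e in ~-sym v~u

    expansion-graph : Graph n
    expansion-graph = record
      { V        = vertices
      ; _~_      = _~F_
      ; _~?_     = λ u v → any? (λ i → edge? (tree (P i)) u v) ⊎-dec joined? u v ⊎-dec joined? v u
      ; ~-sym    = ~F-sym
      ; ~-irrefl = λ { refl u~u → ~-irrefl refl (~F⇒~ u~u) }
      ; ~⇒∈V     = ~F⇒∈
      }
      where
      joined? : ∀ u v → Dec (Joined u v)
      joined? u v = any? λ i → any? λ j → (i <? j) ×-dec ≡-dec _≟_ _≟_ (joint i j) (u , v)
      ~F-sym : ∀ {u v} → u ~F v → v ~F u
      ~F-sym (inj₁ (i , e))  = inj₁ (i , edge-sym (tree (P i)) e)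
      ~F-sym (inj₂ (inj₁ e)) = inj₂ (inj₂ e)
      ~F-sym (inj₂ (inj₂ e)) = inj₂ (inj₁ e)
      ~F⇒∈ : ∀ {u v} → u ~F v → u ∈ vertices
      ~F⇒∈ (inj₁ (i , e))  = ∈-vertices (edge⇒∈ (tree (P i)) e)
      ~F⇒∈ (inj₂ (inj₁ e)) = let _ , _ , _ , _ , u∈ , _ = joined-spec e in ∈-vertices u∈
      ~F⇒∈ (inj₂ (inj₂ e)) = let _ , _ , _ , _ , _ , u∈ , _ = joined-spec e in ∈-vertices u∈

    -- Tree edges stay in one piece, and by disjointness the endpoints of a joint determine its two
    -- indices.
    across : ∀ {i j u v} → i ≢ j → u ∈ S (P i) → v ∈ S (P j) → u ~F v →
      (i Fin.< j × joint i j ≡ (u , v)) ⊎ (j Fin.< i × joint j i ≡ (v , u))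
    across i≢j u∈i v∈j (inj₁ (k , e)) = contradiction
      (trans (same-piece u∈i (edge⇒∈ (tree (P k)) e))
        (same-piece (edge⇒∈ (tree (P k)) (edge-sym (tree (P k)) e)) v∈j)) i≢j
    across i≢j u∈i v∈j (inj₂ (inj₁ e)) with joined-spec e
    ... | k , l , k<l , eq , u∈k , v∈l , _ with refl ← same-piece u∈i u∈k | refl ← same-piece v∈j v∈l =
      inj₁ (k<l , eq)
    across i≢j u∈i v∈j (inj₂ (inj₂ e)) with joined-spec e
    ... | k , l , k<l , eq , v∈k , u∈l , _ with refl ← same-piece u∈i u∈l | refl ← same-piece v∈j v∈k =
      inj₂ (k<l , eq)

    expansion : Expansion t expansion-graph
    expansion = record
      { T        = λ i → tree-graph (tree (P i))
      ; T-tree   = λ i → tree-graph-isTree (tree (P i))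
      ; T⊆F      = λ i → ∈-vertices , λ e → inj₁ (i , e)
      ; disjoint = same-piece
      ; cover    = ∈-tabulate⁻ covered?
      ; inside   = within
      ; between  = between
      }
      where
      within : ∀ {s u v} → u ∈ S (P s) → v ∈ S (P s) → u ~F v → Edge (tree (P s)) u v
      within u∈s v∈s (inj₁ (i , e)) with refl ← same-piece u∈s (edge⇒∈ (tree (P i)) e) = e
      within u∈s v∈s (inj₂ (inj₁ e)) with joined-spec e
      ... | i , j , i<j , _ , u∈i , v∈j , _ =
        contradiction (trans (same-piece u∈i u∈s) (same-piece v∈s v∈j)) (<⇒≢ i<j)
      within u∈s v∈s (inj₂ (inj₂ e)) with joined-spec e
      ... | i , j , i<j , _ , v∈i , u∈j , _ =
        contradiction (trans (same-piece v∈i v∈s) (same-piece u∈s u∈j)) (<⇒≢ i<j)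

      between : ∀ {s s′} → s ≢ s′ →
        ∃! {A = Fin n × Fin n} _≡_ λ (u , v) → u ∈ S (P s) × v ∈ S (P s′) × u ~F v
      between {s} {s′} s≢s′ with <-cmp s s′
      ... | tri≈ _ s≡s′ _ = contradiction s≡s′ s≢s′
      ... | tri< s<s′ _ s′≮s = let u∈ , v∈ , _ = joint-spec s<s′ in
        joint s s′ , (u∈ , v∈ , inj₂ (inj₁ (s , s′ , s<s′ , refl))) ,
        λ (u∈ , v∈ , e) → [ proj₂ , (λ (s′<s , _) → contradiction s′<s s′≮s) ]′ (across s≢s′ u∈ v∈ e)
      ... | tri> s≮s′ _ s′<s = let v∈ , u∈ , _ = joint-spec s′<s in
        swap (joint s′ s) , (u∈ , v∈ , inj₂ (inj₂ (s′ , s , s′<s , refl))) ,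
        λ (u∈ , v∈ , e) → [ (λ (s<s′ , _) → contradiction s<s′ s≮s′) , cong swap ∘ proj₂ ]′ (across s≢s′ u∈ v∈ e)

    expansion-odd : IsOdd expansion
    expansion-odd = col , tree-proper , link-mono
      where
      col : Fin n → Bool
      col v with covered? v
      ... | yes (i , _) = c (P i) v
      -- Oddness constrains only vertices of the trees, so this value is arbitrary.
      ... | no  _       = true

      col-on : ∀ {i v} → v ∈ S (P i) → col v ≡ c (P i) v
      col-on {i} {v} v∈i with covered? v
      ... | yes (j , v∈j) = cong (λ k → c (P k) v) (same-piece v∈j v∈i)
      ... | no  ¬covered  = contradiction (i , v∈i) ¬covered

      tree-proper : ∀ s {u v} → Edge (tree (P s)) u v → col u ≢ col v
      tree-proper s e eq = edge⇒≢ g e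
        (trans (sym (col-on (edge⇒∈ g e))) (trans eq (col-on (edge⇒∈ g (edge-sym g e)))))
        where g = tree (P s)

      link-mono : ∀ {s s′ u v} → s ≢ s′ → u ∈ S (P s) → v ∈ S (P s′) → u ~F v → col u ≡ col v
      link-mono {s} {s′} s≢s′ u∈ v∈ e with across s≢s′ u∈ v∈ e
      ... | inj₁ (s<s′ , eq) = let _ , _ , _ , cu≡cv = subst (Joint s s′) eq (joint-spec s<s′) in
        trans (col-on u∈) (trans cu≡cv (sym (col-on v∈)))
      ... | inj₂ (s′<s , eq) = let _ , _ , _ , cv≡cu = subst (Joint s′ s) eq (joint-spec s′<s) in
        trans (col-on u∈) (trans (sym cv≡cu) (sym (col-on v∈)))

    odd-minor : HasOddKMinor t G
    odd-minor = expansion-graph , (vertices⊆V , ~F⇒~) , expansion , expansion-odd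
      where
      vertices⊆V : vertices ⊆ V G
      vertices⊆V v∈ = let i , v∈i = ∈-tabulate⁻ covered? v∈ in S⊆V (P i) v∈i

  linked⇒odd-minor : ∀ {h t} (Ps : List (Piece h)) → AllPairs OddLink Ps → t ≤ length Ps → HasOddKMinor t G
  linked⇒odd-minor Ps linked t≤ = odd-minor (λ i → lookup Ps (inject≤ i t≤)) λ {i} {j} i<j →
    AllPairs-lookup linked (subst₂ _<_ (sym (toℕ-inject≤ i t≤)) (sym (toℕ-inject≤ j t≤)) i<j)

  -- Monochromatic components and the final count

  component⇒⊆ : ∀ {X C} → IsComponent (induced G X) C → C ⊆ V G ∩ X
  component⇒⊆ {X} (v , v∈ , C⇔) {u} u∈C = reach v∈ (to (C⇔ u) u∈C)
    where
    reach : ∀ {v u} → v ∈ V G ∩ X → Reachable (induced G X) v u → u ∈ V G ∩ X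
    reach v∈ ε                             = v∈
    reach v∈ ((v~w , _ , w∈X) ◅ path) = reach (∈∩⁺ (~⇒∈V (~-sym v~w)) w∈X) path

  -- A path from `x` to `y` through the base vertex stays in `C`, and some edge of it leaves `D`.
  component⇒conn : ∀ {X C} → IsComponent (induced G X) C → Conn C
  component⇒conn {X} {C} (v , v∈ , C⇔) D {x} {y} x∈C x∈D y∈C y∉D =
    cross x∈C x∈D (Star.reverse ~ᵢ-sym (to (C⇔ x) x∈C) ◅◅ to (C⇔ y) y∈C)
    where
    ~ᵢ-sym : ∀ {a b} → Graph._~_ (induced G X) a b → Graph._~_ (induced G X) b a
    ~ᵢ-sym = Graph.~-sym (induced G X)

    cross : ∀ {x} → x ∈ C → x ∈ D → Reachable (induced G X) x y → Crossed C D
    cross x∈C x∈D ε = contradiction x∈D y∉D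
    cross {x} x∈C x∈D (_◅_ {j = z} x~z path) with z ∈? D | from (C⇔ z) (to (C⇔ x) x∈C ◅◅ (x~z ◅ ε))
    ... | yes z∈D | z∈C = cross z∈C z∈D path
    ... | no  z∉D | z∈C = x , z , (x∈C , x∈D) , (z∈C , z∉D) , proj₁ x~z

encode : ∀ {h m} → 2 * h ≡ m → ∃ λ (code : Fin h × Bool → Fin m) → Injective _≡_ _≡_ code
encode {h} refl = code , code-injective
  where
  bit : Bool → Fin 2
  bit true  = Fin.zero
  bit false = Fin.suc Fin.zero

  bit-injective : Injective _≡_ _≡_ bit
  bit-injective {true}  {true}  _ = refl
  bit-injective {false} {false} _ = refl

  code : Fin h × Bool → Fin (2 * h)
  code (x , b) = Fin.combine (bit b) x

  code-injective : Injective _≡_ _≡_ code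
  code-injective {x , b} {y , b′} eq = let bit≡ , x≡y = combine-injective (bit b) x (bit b′) y eq in
    cong₂ _,_ x≡y (bit-injective bit≡)

-- Here `suc j` is `t ∸ 2`. Taking the maximum with 1 costs nothing at `j = 0`, because 3 and 2 have
-- the same rounded half.
half-bound : ∀ {m} j → m + m ≤ 2 + (1 ⊔ j) → m ≤ ⌈ suc j /2⌉
half-bound {m} j 2m≤ = begin
  m                    ≡⟨ ℕ.n≡⌊n+n/2⌋ m ⟩
  ⌊ m + m /2⌋          ≤⟨ ℕ.⌊n/2⌋-mono 2m≤ ⟩
  ⌊ 2 + (1 ⊔ j) /2⌋    ≡⟨ floor j ⟩
  ⌈ suc j /2⌉          ∎
  where
  open ≤-Reasoning
  floor : ∀ j → ⌊ 2 + (1 ⊔ j) /2⌋ ≡ ⌈ suc j /2⌉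
  floor zero    = refl
  floor (suc j) = refl

theorem1 : (t : ℕ) → 3 ≤ t → (n : ℕ) (G : Graph n) → ¬ HasOddKMinor t G →
    Σ[ c ∈ (Fin n → Fin (2 * t ∸ 2)) ]
    ((C : Subset n) → IsMonochromaticComponent G c C → ∣ C ∣ ≤ ⌈ t ∸ 2 /2⌉)
theorem1 (suc (suc (suc j))) (s≤s (s≤s (s≤s _))) n G ¬minor =
  code ∘ f , λ C (s , component) →
    half-bound j (small C (proj₁ ∘ ∈∩⁻ ∘ component⇒⊆ G component) (component⇒conn G component)
      λ x∈C y∈C → code-injective (trans (class component x∈C) (sym (class component y∈C))))
  where
  limit : (Ps : List (Piece G (2 + j))) → AllPairs (OddLink G) Ps → length Ps ≤ 2 + j
  limit Ps linked = ℕ.≮⇒≥ λ t≤ → ¬minor (linked⇒odd-minor G Ps linked t≤)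

  -- The recursion starts from the whole vertex set with no earlier pieces.
  open Colouring (colouring G limit (V G) (<-wellFounded _) id [] [] (λ ()) (λ ()))

  encoding : ∃ λ (code : Fin (2 + j) × Bool → Fin (2 * (3 + j) ∸ 2)) → Injective _≡_ _≡_ code
  encoding = encode (sym (ℕ.+-suc (1 + j) (2 + (j + 0))))

  code = proj₁ encoding
  code-injective = proj₂ encoding

  class : ∀ {s C x} → IsComponent (induced G (colorClass (code ∘ f) s)) C → x ∈ C → code (f x) ≡ s
  class {s} component x∈C = ∈-tabulate⁻ (λ v → code (f v) ≟ s) (proj₂ (∈∩⁻ (component⇒⊆ G component x∈C)))
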